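{- Let $f(X)=X^4+2$. Assume that $|S^2(f,T)|=o(T)$ as $T\to\infty$. Then the set of $d\in\mathbb{N}$ such that $f(d)$ is square-free has a natural density, this density is positive, and it equals $\prod_p\left(1-\frac{\delta_f(p^2)}{p^2}\right)$, where $\delta_f(N)=|\{a\bmod N: f(a)\equiv 0\pmod N\}|$.
   Context: For a natural number $n$, $R_f(n):=\min\{|d|: d\in\mathbb{Z},\ n\mid f(d)\}$ if such $d$ exists, and $R_f(n)=\infty$ otherwise. For real $T$, $S^2(f,T):=\{p \text{ prime}: R_f(p^2)\le T\}$. -}

module Defs where

open import Data.Empty using (⊥)
open import Data.Integer as ℤ using (ℤ; +_)
import Data.Integer.Divisibility as ℤ
open import Data.List using (List; length; filter; upTo)
open import Data.List.Membership.Propositional using (_∈_)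
open import Data.List.Relation.Unary.Unique.Propositional using (Unique)
open import Data.Nat as ℕ using (ℕ; zero; suc; NonZero)
import Data.Nat.Divisibility as ℕ
import Data.Nat.Properties as ℕ
open import Data.Nat.Primality using (Prime; prime?)
open import Data.Product using (∃-syntax; Σ-syntax; _×_; _,_)
open import Data.Rational as ℚ using (ℚ; 0ℚ; 1ℚ; ½; _/_; _+_; _-_; _*_; -_; ∣_∣; _≤_; _<_)
open import Data.Rational.Properties
open import Data.Rational.Solver using (module +-*-Solver)
open import Data.Sum using (inj₁; inj₂)
open import Function.Bundles using (_⇔_)
open import Relation.Binary.PropositionalEquality
open import Relation.Nullary using (¬_; yes; no)
open import Relation.Nullary.Construct.Add.Supremum using (_⁺; [_]; ⊤⁺)
open import Relation.Unary using (Pred)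
open import Level using (0ℓ)

-- Real numbers as Cauchy sequences of rationals.  Two representatives
-- denote the same real when each is _≤ᴿ_ the other; everything below is
-- invariant under this equality.

Eventually : Pred ℕ 0ℓ → Set
Eventually P = ∃[ N ] ∀ n → N ℕ.≤ n → P n

Cauchy : (ℕ → ℚ) → Set
Cauchy a = ∀ ε → 0ℚ < ε → ∃[ N ] ∀ m n → N ℕ.≤ m → N ℕ.≤ n → ∣ a m - a n ∣ ≤ ε

record ℝ : Set where
  constructor real
  field
    seq    : ℕ → ℚ
    cauchy : Cauchy seq

open ℝ public

infix  4 _≤ᴿ_ _<ᴿ_
infixl 6 _-ᴿ_
infixr 7 _·_

_≤ᴿ_ : ℝ → ℝ → Set
x ≤ᴿ y = ∀ ε → 0ℚ < ε → Eventually λ n → seq x n ≤ seq y n + ε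

_<ᴿ_ : ℝ → ℝ → Set
x <ᴿ y = ∃[ ε ] 0ℚ < ε × Eventually λ n → seq x n + ε ≤ seq y n

private
  ∣p-p∣≤ε : ∀ p {ε} → 0ℚ < ε → ∣ p - p ∣ ≤ ε
  ∣p-p∣≤ε p 0<ε = subst (λ q → ∣ q ∣ ≤ _) (sym (+-inverseʳ p)) (<⇒≤ 0<ε)

  half-pos : ∀ {ε} → 0ℚ < ε → 0ℚ < ½ * ε
  half-pos 0<ε = *-monoʳ-<-pos ½ 0<ε

  half+half : ∀ ε → ½ * ε + ½ * ε ≡ ε
  half+half ε = trans (sym (*-distribʳ-+ ε ½ ½)) (*-identityˡ ε)

  sub-rearrange : ∀ a b c d → (a - b) - (c - d) ≡ (a - c) - (b - d)
  sub-rearrange = solve 4 (λ a b c d →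
      (a :- b) :- (c :- d) := (a :- c) :- (b :- d)) refl
    where open +-*-Solver

  sub-close : ∀ a b c d {δ} → ∣ a - c ∣ ≤ δ → ∣ b - d ∣ ≤ δ →
              ∣ (a - b) - (c - d) ∣ ≤ δ + δ
  sub-close a b c d ac bd =
    ≤-trans (≤-reflexive (cong ∣_∣ (sub-rearrange a b c d)))
      (≤-trans (∣p-q∣≤∣p∣+∣q∣ (a - c) (b - d)) (+-mono-≤ ac bd))

  ∣p∣-∣q∣≤∣p-q∣ : ∀ p q → ∣ p ∣ - ∣ q ∣ ≤ ∣ p - q ∣
  ∣p∣-∣q∣≤∣p-q∣ p q = begin
    ∣ p ∣ - ∣ q ∣                 ≡⟨ cong (λ r → ∣ r ∣ - ∣ q ∣) (split p q) ⟩
    ∣ (p - q) + q ∣ - ∣ q ∣       ≤⟨ +-monoˡ-≤ (- ∣ q ∣) (∣p+q∣≤∣p∣+∣q∣ (p - q) q) ⟩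
    (∣ p - q ∣ + ∣ q ∣) - ∣ q ∣   ≡⟨ cancel ∣ p - q ∣ ∣ q ∣ ⟩
    ∣ p - q ∣                     ∎
    where
    open ≤-Reasoning
    open +-*-Solver
    split : ∀ p q → p ≡ (p - q) + q
    split = solve 2 (λ p q → p := (p :- q) :+ q) refl
    cancel : ∀ a b → (a + b) - b ≡ a
    cancel = solve 2 (λ a b → (a :+ b) :- b := a) refl

  -‿swap : ∀ p q → - (p - q) ≡ q - p
  -‿swap = solve 2 (λ p q → :- (p :- q) := q :- p) refl
    where open +-*-Solver

  abs-close : ∀ p q → ∣ ∣ p ∣ - ∣ q ∣ ∣ ≤ ∣ p - q ∣
  abs-close p q with ∣p∣≡p∨∣p∣≡-p (∣ p ∣ - ∣ q ∣)
  ... | inj₁ eq = ≤-trans (≤-reflexive eq) (∣p∣-∣q∣≤∣p-q∣ p q)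
  ... | inj₂ eq = ≤-trans (≤-reflexive (trans eq (-‿swap ∣ p ∣ ∣ q ∣)))
      (≤-trans (∣p∣-∣q∣≤∣p-q∣ q p)
        (≤-reflexive (trans (cong ∣_∣ (sym (-‿swap p q))) (∣-p∣≡∣p∣ (p - q)))))

  scale-eq : ∀ q a b → ∣ q * a - q * b ∣ ≡ ∣ q ∣ * ∣ a - b ∣
  scale-eq q a b = trans (cong ∣_∣ (factor q a b)) (∣p*q∣≡∣p∣*∣q∣ q (a - b))
    where
    open +-*-Solver
    factor : ∀ q a b → q * a - q * b ≡ q * (a - b)
    factor = solve 3 (λ q a b → q :* a :- q :* b := q :* (a :- b)) refl

  scale-cauchy : ∀ q {a} → Cauchy a → Cauchy (λ n → q * a n)
  scale-cauchy q {a} ca ε 0<ε = let (N , close) = ca δ 0<δ in N , λ m n N≤m N≤n → begin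
      ∣ q * a m - q * a n ∣    ≡⟨ scale-eq q (a m) (a n) ⟩
      ∣ q ∣ * ∣ a m - a n ∣    ≤⟨ *-monoˡ-≤-nonNeg ∣ q ∣ {{∣-∣-nonNeg q}} (close m n N≤m N≤n) ⟩
      ∣ q ∣ * δ                ≤⟨ *-monoʳ-≤-nonNeg δ {{pos⇒nonNeg δ {{ℚ.positive 0<δ}}}} ∣q∣≤c ⟩
      c * (1/c * ε)            ≡⟨ *-assoc c 1/c ε ⟨
      (c * 1/c) * ε            ≡⟨ cong (_* ε) (*-inverseʳ c {{c≢0}}) ⟩
      1ℚ * ε                   ≡⟨ *-identityˡ ε ⟩
      ε                        ∎
    where
    open ≤-Reasoning
    c : ℚ
    c = ∣ q ∣ + 1ℚ
    c>0 : ℚ.Positive c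
    c>0 = nonNeg+pos⇒pos ∣ q ∣ {{∣-∣-nonNeg q}} 1ℚ
    c≢0 : ℚ.NonZero c
    c≢0 = pos⇒nonZero c {{c>0}}
    1/c : ℚ
    1/c = (ℚ.1/ c) {{c≢0}}
    1/c>0 : ℚ.Positive 1/c
    1/c>0 = 1/pos⇒pos c {{c>0}}
    δ : ℚ
    δ = 1/c * ε
    0<δ : 0ℚ < δ
    0<δ = positive⁻¹ δ {{pos*pos⇒pos 1/c {{1/c>0}} ε {{ℚ.positive 0<ε}}}}
    ∣q∣≤c : ∣ q ∣ ≤ c
    ∣q∣≤c = ≤-trans (≤-reflexive (sym (+-identityʳ ∣ q ∣)))
                    (+-monoʳ-≤ ∣ q ∣ (<⇒≤ (positive⁻¹ 1ℚ)))

fromℚ : ℚ → ℝ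
fromℚ q = real (λ _ → q) λ ε 0<ε → 0 , λ _ _ _ _ → ∣p-p∣≤ε q 0<ε

fromℕ : ℕ → ℝ
fromℕ n = fromℚ (+ n / 1)

_-ᴿ_ : ℝ → ℝ → ℝ
seq    (x -ᴿ y) n = seq x n - seq y n
cauchy (x -ᴿ y) ε 0<ε =
  let (M , closeˣ) = cauchy x (½ * ε) (half-pos 0<ε)
      (N , closeʸ) = cauchy y (½ * ε) (half-pos 0<ε)
  in M ℕ.⊔ N , λ m n ⊔≤m ⊔≤n → subst (_ ≤_) (half+half ε)
       (sub-close (seq x m) (seq y m) (seq x n) (seq y n)
         (closeˣ m n (ℕ.m⊔n≤o⇒m≤o M N ⊔≤m) (ℕ.m⊔n≤o⇒m≤o M N ⊔≤n))
         (closeʸ m n (ℕ.m⊔n≤o⇒n≤o M N ⊔≤m) (ℕ.m⊔n≤o⇒n≤o M N ⊔≤n)))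

∣_∣ᴿ : ℝ → ℝ
seq    ∣ x ∣ᴿ n = ∣ seq x n ∣
cauchy ∣ x ∣ᴿ ε 0<ε =
  let (N , close) = cauchy x ε 0<ε
  in N , λ m n N≤m N≤n → ≤-trans (abs-close (seq x m) (seq x n)) (close m n N≤m N≤n)

_·_ : ℚ → ℝ → ℝ
seq    (q · x) n = q * seq x n
cauchy (q · x)   = scale-cauchy q (cauchy x)

infix 4 _⟶_

_⟶_ : (ℕ → ℚ) → ℝ → Set
a ⟶ x = ∀ ε → 0ℚ < ε → Eventually λ n → ∣ fromℚ (a n) -ᴿ x ∣ᴿ ≤ᴿ fromℚ ε

HasCard : Pred ℕ 0ℓ → ℕ → Set
HasCard P k = ∃[ xs ] Unique xs × (∀ n → n ∈ xs ⇔ P n) × length xs ≡ k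

-- |S(T)| = o(T) as T → ∞.  Membership in S(T) may be undecidable for a
-- particular real T, so the bound is on whatever cardinal S(T) has,
-- rather than asserting that one can be exhibited for every T.
CardIsLittleO : (ℝ → Pred ℕ 0ℓ) → Set
CardIsLittleO S = ∀ ε → 0ℚ < ε → ∃[ T₀ ] ∀ T → T₀ ≤ᴿ T →
  ∀ k → HasCard (S T) k → fromℕ k ≤ᴿ ε · T

HasNaturalDensity : Pred ℕ 0ℓ → ℝ → Set
HasNaturalDensity A D = Σ[ count ∈ (ℕ → ℕ) ]
  (∀ N → HasCard (λ d → 1 ℕ.≤ d × d ℕ.≤ N × A d) (count N)) ×
  (λ n → (+ count (suc n)) / suc n) ⟶ D

primeProductUpTo : ((p : ℕ) .{{_ : NonZero p}} → ℚ) → ℕ → ℚ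
primeProductUpTo a zero = 1ℚ
primeProductUpTo a (suc n) with prime? (suc n)
... | yes _ = primeProductUpTo a n * a (suc n)
... | no  _ = primeProductUpTo a n

IsPrimeProduct : ((p : ℕ) .{{_ : NonZero p}} → ℚ) → ℝ → Set
IsPrimeProduct a D = primeProductUpTo a ⟶ D

Squarefree : ℤ → Set
Squarefree n = ∀ d → (d ℤ.* d) ℤ.∣ n → ℤ.∣ d ∣ ≡ 1

-- The graph of R_f : ℕ → ℕ ∪ {∞}, with ⊤⁺ as ∞.
IsR : (ℤ → ℤ) → ℕ → ℕ ⁺ → Set
IsR f n [ r ] = (∃[ d ] ℤ.∣ d ∣ ≡ r × + n ℤ.∣ f d) ×
                (∀ d → + n ℤ.∣ f d → r ℕ.≤ ℤ.∣ d ∣)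
IsR f n ⊤⁺    = ¬ (∃[ d ] + n ℤ.∣ f d)

_≤∞_ : ℕ ⁺ → ℝ → Set
[ r ] ≤∞ T = fromℕ r ≤ᴿ T
⊤⁺    ≤∞ T = ⊥

S² : (ℤ → ℤ) → ℝ → Pred ℕ 0ℓ
S² f T p = Prime p × ∃[ r ] IsR f (p ℕ.^ 2) r × r ≤∞ T

δ : (ℤ → ℤ) → ℕ → ℕ
δ f N = length (filter (λ a → N ℕ.∣? ℤ.∣ f (+ a) ∣) (upTo N))

eulerFactor : (ℤ → ℤ) → (p : ℕ) .{{_ : NonZero p}} → ℚ
eulerFactor f p@(suc _) = 1ℚ - (+ δ f (p ℕ.^ 2) / (p ℕ.^ 2))

f : ℤ → ℤ
f X = X ℤ.^ 4 ℤ.+ + 2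

{-# OPTIONS --safe #-}
-- Let A_z(N) count the d ≤ N for which no p ≤ z has p² ∣ d⁴ + 2, and Q(N) those with d⁴ + 2
-- square-free.  By the Chinese remainder theorem A_z(N)/N tends to the partial Euler product 𝒫 z.  A d
-- counted by A_z(N) but not by Q(N) satisfies p² ∣ d⁴ + 2 for some p > z, and then p lies in S²(f, N).
-- Since d⁴ + 2 has at most 4 roots modulo p², there are at most
--   ∑ 4 (N/p² + 1) ≤ 4 N/z + 4 |S²(f, N)|
-- such d, where the sum is over the p > z in S²(f, N), and by hypothesis the last term is o(N).
-- The same bound on the number of roots gives 𝒫 z - 𝒫 w ≤ 4/z for z ≤ w: hence the product converges,
-- and it is positive because 𝒫 8 > 4/8.
module Submission where

open import Defs
open import Data.Bool using (if_then_else_)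
open import Data.Nat
open import Data.Nat.Properties
open import Data.Nat.Divisibility
open import Data.Nat.DivMod using (m%n<n; m≡m%n+[m/n]*n; m/n*n≤m; m*n/n≡m; /-monoˡ-≤)
open import Data.Nat.ListAction using (product)
open import Data.Nat.Primality
open import Data.Nat.Primality.Factorisation using (factorise)
open import Data.Nat.Solver using (module +-*-Solver)
open import Data.Integer as ℤ using (ℤ; +_; -[1+_])
import Data.Integer.Divisibility.Signed as ℤ
import Data.Integer.Properties as ℤ
import Data.Integer.Solver as ℤ
open import Data.List using (_∷_; applyUpTo; filter; length; map; upTo)
open import Data.List.Membership.Propositional using (_∈_)
open import Data.List.Membership.Propositional.Properties
  using (∈-map⁺; ∈-map⁻; ∈-filter⁺; ∈-filter⁻; ∈-upTo⁺; ∈-upTo⁻)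
open import Data.List.Properties using (length-map)
open import Data.List.Relation.Unary.All using (_∷_)
import Data.List.Relation.Unary.Unique.Propositional.Properties as Unique
open import Data.Product using (_×_; _,_; proj₁; proj₂; ∃; ∃-syntax)
open import Data.Rational as ℚ using (ℚ; 0ℚ; 1ℚ)
import Data.Rational.Properties as ℚ
import Data.Rational.Solver as ℚ
open import Data.Rational.Unnormalised as ℚᵘ using (mkℚᵘ)
import Data.Rational.Unnormalised.Properties as ℚᵘ
open import Data.Sum as Sum using (_⊎_; inj₁; inj₂)
open import Function using (_∘_; id; mk⇔; Equivalence; _⇔_)
open import Relation.Binary using (tri<; tri≈; tri>)
open import Relation.Binary.PropositionalEquality
open import Relation.Nullary
open import Relation.Nullary.Construct.Add.Supremum using ([_])
open import Relation.Nullary.Decidable using (¬?; _×-dec_; _→-dec_; map′)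
open import Relation.Unary using (Decidable)

-- Finite sums and counting

-- The obstacle is the rounding term 1 in N/p² + 1. A prime with p² dividing some f(d), d ≤ N, can
-- be as large as about N², so summing this 1 over all candidate primes would swamp N; it must be
-- charged only to primes that really occur, and their number is what the hypothesis controls. The
-- main terms N/p² may then be summed over all integers above z. The order of choices matters: z is
-- fixed by ε alone, and N is taken large in terms of z afterwards, since the period of the sieve,
-- the product of p² over p ≤ z, grows very fast. The hypothesis speaks of a cardinality of S²(f,
-- N), so this set has to be listed: p ≤ f(N) bounds the search, and R_f(p²) is found as a least
-- root. Positivity needs an explicit tail bound, because positive factors alone do not keep an
-- infinite product away from 0.

infix 2 ∑-syntax

∑ : ℕ → (ℕ → ℕ) → ℕ
∑ zero    g = 0
∑ (suc n) g = g 0 + ∑ n (g ∘ suc)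

∑-syntax : ℕ → (ℕ → ℕ) → ℕ
∑-syntax = ∑

syntax ∑-syntax n (λ i → e) = ∑[ i < n ] e

∑-mono : ∀ n {g h} → (∀ {i} → i < n → g i ≤ h i) → ∑ n g ≤ ∑ n h
∑-mono zero    le = z≤n
∑-mono (suc n) le = +-mono-≤ (le (s≤s z≤n)) (∑-mono n (le ∘ s≤s))

∑-cong : ∀ n {g h} → (∀ {i} → i < n → g i ≡ h i) → ∑ n g ≡ ∑ n h
∑-cong n eq = ≤-antisym (∑-mono n (≤-reflexive ∘ eq)) (∑-mono n (≤-reflexive ∘ sym ∘ eq))

∑-const : ∀ n c → (∑[ _ < n ] c) ≡ n * c
∑-const zero    c = refl
∑-const (suc n) c = cong (_+_ c) (∑-const n c)

∑-+ : ∀ n g h → (∑[ i < n ] g i + h i) ≡ ∑ n g + ∑ n h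
∑-+ zero    g h = refl
∑-+ (suc n) g h = trans (cong (_+_ (g 0 + h 0)) (∑-+ n (g ∘ suc) (h ∘ suc)))
  (solve 4 (λ a b c d → a :+ b :+ (c :+ d) := a :+ c :+ (b :+ d)) refl
    (g 0) (h 0) (∑ n (g ∘ suc)) (∑ n (h ∘ suc)))
  where open +-*-Solver

∑-*ˡ : ∀ n c g → (∑[ i < n ] c * g i) ≡ c * ∑ n g
∑-*ˡ zero    c g = sym (*-zeroʳ c)
∑-*ˡ (suc n) c g = trans (cong (_+_ (c * g 0)) (∑-*ˡ n c (g ∘ suc))) (sym (*-distribˡ-+ c (g 0) _))

∑-*ʳ : ∀ n c g → (∑[ i < n ] g i * c) ≡ ∑ n g * c
∑-*ʳ n c g = trans (∑-cong n (λ {i} _ → *-comm (g i) c)) (trans (∑-*ˡ n c g) (*-comm c _))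

∑-swap : ∀ m n (g : ℕ → ℕ → ℕ) → (∑[ i < m ] ∑[ j < n ] g i j) ≡ (∑[ j < n ] ∑[ i < m ] g i j)
∑-swap zero    n g = sym (trans (∑-const n 0) (*-zeroʳ n))
∑-swap (suc m) n g = trans (cong (_+_ (∑ n (g 0))) (∑-swap m n (g ∘ suc))) (sym (∑-+ n (g 0) _))

∑-split : ∀ m n g → ∑ (m + n) g ≡ ∑ m g + (∑[ j < n ] g (m + j))
∑-split zero    n g = refl
∑-split (suc m) n g = trans (cong (_+_ (g 0)) (∑-split m n (g ∘ suc))) (sym (+-assoc (g 0) _ _))

∑-blocks : ∀ k m g → ∑ (k * m) g ≡ (∑[ j < k ] ∑[ i < m ] g (j * m + i))
∑-blocks zero    m g = refl
∑-blocks (suc k) m g = trans (∑-split m (k * m) g) (cong (_+_ (∑ m g))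
  (trans (∑-blocks k m (λ i → g (m + i)))
    (∑-cong k λ {j} _ → ∑-cong m λ {i} _ → cong g (sym (+-assoc m (j * m) i)))))

∑-monoˡ : ∀ {m n} g → m ≤ n → ∑ m g ≤ ∑ n g
∑-monoˡ {m} {n} g m≤n = begin
  ∑ m g                                ≤⟨ m≤m+n _ _ ⟩
  ∑ m g + (∑[ j < n ∸ m ] g (m + j))   ≡⟨ ∑-split m (n ∸ m) g ⟨
  ∑ (m + (n ∸ m)) g                    ≡⟨ cong (λ k → ∑ k g) (m+[n∸m]≡n m≤n) ⟩
  ∑ n g                                ∎
  where open ≤-Reasoning

∑-term : ∀ {n i} g → i < n → g i ≤ ∑ n g
∑-term {suc n} {zero}  g _         = m≤m+n _ _
∑-term {suc n} {suc i} g (s≤s i<n) = m≤n⇒m≤o+n (g 0) (∑-term (g ∘ suc) i<n)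

-- Adding `g 0` to either side gives the sum of the first `n + 1` values.
∑-rotate : ∀ n g → g n ≡ g 0 → ∑ n (g ∘ suc) ≡ ∑ n g
∑-rotate n g gn≡g0 = +-cancelˡ-≡ (g 0) _ _ (begin
  ∑ (suc n) g            ≡⟨ cong (λ k → ∑ k g) (+-comm 1 n) ⟩
  ∑ (n + 1) g            ≡⟨ ∑-split n 1 g ⟩
  ∑ n g + (g (n + 0) + 0) ≡⟨ cong (_+_ (∑ n g)) (trans (+-identityʳ _) (trans (cong g (+-identityʳ n)) gn≡g0)) ⟩
  ∑ n g + g 0            ≡⟨ +-comm (∑ n g) (g 0) ⟩
  g 0 + ∑ n g            ∎)
  where open ≡-Reasoning

χ : {P : Set} → Dec P → ℕ
χ p = if does p then 1 else 0

χ-yes : {P : Set} (p : Dec P) → P → χ p ≡ 1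
χ-yes (yes _) x = refl
χ-yes (no ¬x) x = contradiction x ¬x

χ-no : {P : Set} (p : Dec P) → ¬ P → χ p ≡ 0
χ-no (yes x) ¬x = contradiction x ¬x
χ-no (no _)  ¬x = refl

χ≤1 : {P : Set} (p : Dec P) → χ p ≤ 1
χ≤1 (yes _) = ≤-refl
χ≤1 (no _)  = z≤n

χ≤ : ∀ {P : Set} {n} (p : Dec P) → (P → 1 ≤ n) → χ p ≤ n
χ≤ (yes x) le = le x
χ≤ (no _)  le = z≤n

χ-mono : {P Q : Set} (p : Dec P) (q : Dec Q) → (P → Q) → χ p ≤ χ q
χ-mono p q f = χ≤ p λ x → ≤-reflexive (sym (χ-yes q (f x)))

χ-cong : {P Q : Set} (p : Dec P) (q : Dec Q) → P ⇔ Q → χ p ≡ χ q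
χ-cong p q e = ≤-antisym (χ-mono p q (Equivalence.to e)) (χ-mono q p (Equivalence.from e))

χ-¬ : {P : Set} (p : Dec P) → χ p + χ (¬? p) ≡ 1
χ-¬ (yes _) = refl
χ-¬ (no _)  = refl

χ-× : {P Q : Set} (p : Dec P) (q : Dec Q) → χ (p ×-dec q) ≡ χ p * χ q
χ-× (yes _) q = sym (+-identityʳ (χ q))
χ-× (no _)  q = refl

count : {P : ℕ → Set} → Decidable P → ℕ → ℕ
count P? n = ∑[ i < n ] χ (P? i)

count-length : {P : ℕ → Set} (P? : Decidable P) → ∀ n → length (filter P? (upTo n)) ≡ count P? n
count-length P? = go id
  where
  go : ∀ g n → length (filter P? (applyUpTo g n)) ≡ (∑[ i < n ] χ (P? (g i)))
  go g zero = refl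
  go g (suc n) with P? (g 0)
  ... | yes _ = cong suc (go (g ∘ suc) n)
  ... | no _  = go (g ∘ suc) n

count-unique : {P : ℕ → Set} (P? : Decidable P) → ∀ n →
               (∀ {i j} → i < n → j < n → P i → P j → i ≡ j) → count P? n ≤ 1
count-unique P? zero    uniq = z≤n
count-unique P? (suc n) uniq with P? 0
... | no _  = count-unique (P? ∘ suc) n λ i<n j<n p q → suc-injective (uniq (s≤s i<n) (s≤s j<n) p q)
... | yes p = s≤s (≤-reflexive (trans
  (∑-cong n {h = λ _ → 0} λ {i} i<n → χ-no (P? (suc i)) λ q → 1+n≢0 (uniq (s≤s i<n) (s≤s z≤n) q p))
  (trans (∑-const n 0) (*-zeroʳ n))))

count-cong : {P Q : ℕ → Set} (P? : Decidable P) (Q? : Decidable Q) →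
             (∀ i → P i ⇔ Q i) → ∀ n → count P? n ≡ count Q? n
count-cong P? Q? e n = ∑-cong n λ {i} _ → χ-cong (P? i) (Q? i) (e i)

-- The indicator of `P` is at most the sum of four indicators of single points. The points may
-- coincide, so a caller with fewer candidates repeats one or supplies a dummy.
count-≤4 : {P : ℕ → Set} (P? : Decidable P) → ∀ n a b c d →
           (∀ {i} → i < n → P i → (i ≡ a ⊎ i ≡ b) ⊎ (i ≡ c ⊎ i ≡ d)) → count P? n ≤ 4
count-≤4 P? n a b c d cases = begin
  count P? n
    ≤⟨ ∑-mono n (λ {i} i<n → χ≤ (P? i) (λ p → indicator (cases i<n p))) ⟩
  (∑[ i < n ] (χ (i ≟ a) + χ (i ≟ b)) + (χ (i ≟ c) + χ (i ≟ d)))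
    ≡⟨ trans (∑-+ n _ _) (cong₂ _+_ (∑-+ n _ _) (∑-+ n _ _)) ⟩
  ((∑[ i < n ] χ (i ≟ a)) + (∑[ i < n ] χ (i ≟ b))) + ((∑[ i < n ] χ (i ≟ c)) + (∑[ i < n ] χ (i ≟ d)))
    ≤⟨ +-mono-≤ (+-mono-≤ (single a) (single b)) (+-mono-≤ (single c) (single d)) ⟩
  4 ∎
  where
  open ≤-Reasoning
  single : ∀ r → (∑[ i < n ] χ (i ≟ r)) ≤ 1
  single r = count-unique (_≟ r) n λ _ _ i≡r j≡r → trans i≡r (sym j≡r)
  pair : ∀ {i} r s → i ≡ r ⊎ i ≡ s → 1 ≤ χ (i ≟ r) + χ (i ≟ s)
  pair {i} r s (inj₁ e) = ≤-trans (≤-reflexive (sym (χ-yes (i ≟ r) e))) (m≤m+n _ _)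
  pair {i} r s (inj₂ e) = ≤-trans (≤-reflexive (sym (χ-yes (i ≟ s) e))) (m≤n+m _ (χ (i ≟ r)))
  indicator : ∀ {i} → (i ≡ a ⊎ i ≡ b) ⊎ (i ≡ c ⊎ i ≡ d) →
              1 ≤ (χ (i ≟ a) + χ (i ≟ b)) + (χ (i ≟ c) + χ (i ≟ d))
  indicator {i} (inj₁ e) = ≤-trans (pair a b e) (m≤m+n _ _)
  indicator {i} (inj₂ e) = ≤-trans (pair c d e) (m≤n+m _ (χ (i ≟ a) + χ (i ≟ b)))

-- Double counting: each `g (σ k)` is spread over the possible values `b` of `σ k`, and by
-- injectivity each `b` is taken at most once.
∑-injective-≤ : ∀ {m n} (σ : ℕ → ℕ) g → (∀ {k} → k < m → σ k < n) →
                (∀ {i j} → i < m → j < m → σ i ≡ σ j → i ≡ j) →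
                (∑[ k < m ] g (σ k)) ≤ ∑ n g
∑-injective-≤ {m} {n} σ g σ<n inj = begin
  (∑[ k < m ] g (σ k))                            ≤⟨ ∑-mono m (λ {k} k<m → expand (σ<n k<m)) ⟩
  (∑[ k < m ] ∑[ b < n ] g b * χ (σ k ≟ b))     ≡⟨ ∑-swap m n _ ⟩
  (∑[ b < n ] ∑[ k < m ] g b * χ (σ k ≟ b))     ≡⟨ ∑-cong n (λ {b} _ → ∑-*ˡ m (g b) _) ⟩
  (∑[ b < n ] g b * count (λ k → σ k ≟ b) m)      ≤⟨ ∑-mono n (λ {b} _ → *-monoʳ-≤ (g b) (fibre b)) ⟩
  (∑[ b < n ] g b * 1)                            ≡⟨ ∑-cong n (λ {b} _ → *-identityʳ (g b)) ⟩
  ∑ n g                                           ∎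
  where
  open ≤-Reasoning
  expand : ∀ {c} → c < n → g c ≤ (∑[ b < n ] g b * χ (c ≟ b))
  expand {c} c<n = ≤-trans (≤-reflexive (sym (trans (cong (g c *_) (χ-yes (c ≟ c) refl)) (*-identityʳ _))))
                           (∑-term _ c<n)
  fibre : ∀ b → count (λ k → σ k ≟ b) m ≤ 1
  fibre b = count-unique (λ k → σ k ≟ b) m λ i<m j<m p q → inj i<m j<m (trans p (sym q))

-- Periodic predicates and the Chinese remainder theorem

Periodic : ℕ → (ℕ → Set) → Set
Periodic m P = ∀ k i → P (k * m + i) ⇔ P i

module _ {P : ℕ → Set} (P? : Decidable P) {m : ℕ} (per : Periodic m P) where

  χ-periodic : ∀ k i → χ (P? (k * m + i)) ≡ χ (P? i)
  χ-periodic k i = χ-cong (P? (k * m + i)) (P? i) (per k i)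

  count-periodic : ∀ k → count P? (k * m) ≡ k * count P? m
  count-periodic k = begin
    count P? (k * m)                                    ≡⟨ ∑-blocks k m _ ⟩
    (∑[ j < k ] ∑[ i < m ] χ (P? (j * m + i)))        ≡⟨ ∑-cong k (λ {j} _ → ∑-cong m λ {i} _ → χ-periodic j i) ⟩
    (∑[ _ < k ] count P? m)                             ≡⟨ ∑-const k _ ⟩
    k * count P? m                                      ∎
    where open ≡-Reasoning

  module _ .{{_ : NonZero m}} where

    count-≥ : ∀ n → n / m * count P? m ≤ count P? n
    count-≥ n = ≤-trans (≤-reflexive (sym (count-periodic (n / m)))) (∑-monoˡ _ (m/n*n≤m n m))

    n≤suc[n/m]*m : ∀ n → n ≤ suc (n / m) * m
    n≤suc[n/m]*m n = ≤-trans (≤-reflexive (m≡m%n+[m/n]*n n m)) (+-monoˡ-≤ _ (<⇒≤ (m%n<n n m)))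

    count-≤ : ∀ n → count P? n ≤ suc (n / m) * count P? m
    count-≤ n = ≤-trans (∑-monoˡ _ (n≤suc[n/m]*m n)) (≤-reflexive (count-periodic (suc (n / m))))

    -- Rounding `n` up to a multiple of `m` adds at most one period. With denominators cleared, this
    -- and `count-lower` say that the frequency of `P` below `n` differs from its frequency in a
    -- period by at most `count P? m / n`.
    count-upper : ∀ n → count P? n * m ≤ n * count P? m + m * count P? m
    count-upper n = begin
      count P? n * m                       ≤⟨ *-monoˡ-≤ m (count-≤ n) ⟩
      suc (n / m) * c * m                  ≡⟨ solve 3 (λ a c m → (con 1 :+ a) :* c :* m := a :* m :* c :+ m :* c) refl (n / m) c m ⟩
      n / m * m * c + m * c                ≤⟨ +-monoˡ-≤ (m * c) (*-monoˡ-≤ c (m/n*n≤m n m)) ⟩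
      n * c + m * c                        ∎
      where
      open ≤-Reasoning
      open +-*-Solver
      c = count P? m

    count-lower : ∀ n → n * count P? m ≤ count P? n * m + m * count P? m
    count-lower n = begin
      n * c                                ≤⟨ *-monoˡ-≤ c (n≤suc[n/m]*m n) ⟩
      suc (n / m) * m * c                  ≡⟨ solve 3 (λ a c m → (con 1 :+ a) :* m :* c := a :* c :* m :+ m :* c) refl (n / m) c m ⟩
      n / m * c * m + m * c                ≤⟨ +-monoˡ-≤ (m * c) (*-monoˡ-≤ m (count-≥ n)) ⟩
      count P? n * m + m * c               ∎
      where
      open ≤-Reasoning
      open +-*-Solver
      c = count P? m

Periodic-× : ∀ {P Q m n} → Periodic m P → Periodic n Q → Periodic (n * m) (λ i → P i × Q i)
Periodic-× {P} {Q} {m} {n} perP perQ k i = mk⇔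
  (λ (p , q) → Equivalence.to (perP (k * n) i) (subst P eqP p) , Equivalence.to (perQ (k * m) i) (subst Q eqQ q))
  (λ (p , q) → subst P (sym eqP) (Equivalence.from (perP (k * n) i) p) ,
               subst Q (sym eqQ) (Equivalence.from (perQ (k * m) i) q))
  where
  open +-*-Solver
  eqP : k * (n * m) + i ≡ k * n * m + i
  eqP = cong (_+ i) (sym (*-assoc k n m))
  eqQ : k * (n * m) + i ≡ k * m * n + i
  eqQ = solve 4 (λ k n m i → k :* (n :* m) :+ i := k :* m :* n :+ i) refl k n m i

Periodic-¬ : ∀ {P m} → Periodic m P → Periodic m (λ i → ¬ P i)
Periodic-¬ per k i = mk⇔ (_∘ Equivalence.from (per k i)) (_∘ Equivalence.to (per k i))

Periodic-⇔ : ∀ {P Q m} → (∀ i → P i ⇔ Q i) → Periodic m Q → Periodic m P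
Periodic-⇔ {m = m} e per k i = mk⇔
  (Equivalence.from (e i) ∘ Equivalence.to (per k i) ∘ Equivalence.to (e (k * m + i)))
  (Equivalence.from (e (k * m + i)) ∘ Equivalence.from (per k i) ∘ Equivalence.to (e i))

-- Coprimality of `m` and `n` is expressed as the right to cancel `m` under divisibility by `n`,
-- which is the form that `prime²-cancel` provides.
module ChineseRemainder {P Q : ℕ → Set} (P? : Decidable P) (Q? : Decidable Q) {m n : ℕ} .{{_ : NonZero n}}
  (perP : Periodic m P) (perQ : Periodic n Q) (coprime : ∀ x → n ∣ x * m → n ∣ x) where

  %-periodic : ∀ {R : ℕ → Set} (R? : Decidable R) → Periodic n R → ∀ x → χ (R? (x % n)) ≡ χ (R? x)
  %-periodic R? per x = sym (trans
    (cong (χ ∘ R?) (trans (m≡m%n+[m/n]*n x n) (+-comm (x % n) _)))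
    (χ-periodic R? per (x / n) (x % n)))

  progression-≤ : ∀ {R : ℕ → Set} (R? : Decidable R) → Periodic n R → ∀ a →
                  (∑[ k < n ] χ (R? (k * m + a))) ≤ count R? n
  progression-≤ R? per a = begin
    (∑[ k < n ] χ (R? (k * m + a)))         ≡⟨ ∑-cong n (λ {k} _ → %-periodic R? per (k * m + a)) ⟨
    (∑[ k < n ] χ (R? ((k * m + a) % n)))   ≤⟨ ∑-injective-≤ σ _ (λ {k} _ → m%n<n (k * m + a) n) inj ⟩
    count R? n                              ∎
    where
    open ≤-Reasoning
    σ : ℕ → ℕ
    σ k = (k * m + a) % n
    -- If the residues agreed, `n` would divide `(j ∸ i) * m`, hence `j ∸ i`, which is positive and
    -- below `n`. As `i < j`, the truncated differences are true ones.
    separated : ∀ {i j} → i < j → j < n → σ i ≢ σ j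
    separated {i} {j} i<j j<n eq = >⇒∤ {{>-nonZero (m<n⇒0<n∸m i<j)}} (≤-<-trans (m∸n≤m j i) j<n)
      (coprime (j ∸ i) (subst (n ∣_) diff (%-≡⇒∣-∸ _ _ (sym eq))))
      where
      %-≡⇒∣-∸ : ∀ x y → x % n ≡ y % n → n ∣ x ∸ y
      %-≡⇒∣-∸ x y e = divides (x / n ∸ y / n) (begin-equality
        x ∸ y                                       ≡⟨ cong₂ _∸_ (m≡m%n+[m/n]*n x n) (m≡m%n+[m/n]*n y n) ⟩
        (x % n + x / n * n) ∸ (y % n + y / n * n)   ≡⟨ cong (λ r → (r + x / n * n) ∸ (y % n + y / n * n)) e ⟩
        (y % n + x / n * n) ∸ (y % n + y / n * n)   ≡⟨ [m+n]∸[m+o]≡n∸o (y % n) _ _ ⟩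
        x / n * n ∸ y / n * n                       ≡⟨ *-distribʳ-∸ n (x / n) (y / n) ⟨
        (x / n ∸ y / n) * n                         ∎)
      diff : (j * m + a) ∸ (i * m + a) ≡ (j ∸ i) * m
      diff = trans ([m+n]∸[o+n]≡m∸o (j * m) a (i * m)) (sym (*-distribʳ-∸ m j i))
        where
        [m+n]∸[o+n]≡m∸o : ∀ x y z → (x + y) ∸ (z + y) ≡ x ∸ z
        [m+n]∸[o+n]≡m∸o x y z = trans (cong₂ _∸_ (+-comm x y) (+-comm z y)) ([m+n]∸[m+o]≡n∸o y x z)
    inj : ∀ {i j} → i < n → j < n → σ i ≡ σ j → i ≡ j
    inj {i} {j} i<n j<n eq with <-cmp i j
    ... | tri< i<j _ _ = contradiction eq (separated i<j j<n)
    ... | tri≈ _ i≡j _ = i≡j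
    ... | tri> _ _ j<i = contradiction (sym eq) (separated j<i i<n)

  -- The inequality for Q and for its complement add up to the equality n = n.
  progression-count : ∀ a → (∑[ k < n ] χ (Q? (k * m + a))) ≡ count Q? n
  progression-count a = ≤-antisym (progression-≤ Q? perQ a) (+-cancelʳ-≤ (∑ n Q̅) _ _ (begin
      count Q? n + ∑ n Q̅                     ≤⟨ +-monoʳ-≤ (count Q? n) (progression-≤ (λ i → ¬? (Q? i)) (Periodic-¬ perQ) a) ⟩
      count Q? n + count (λ i → ¬? (Q? i)) n ≡⟨ total (λ i → i) ⟩
      n * 1                                  ≡⟨ total (λ k → k * m + a) ⟨
      (∑[ k < n ] χ (Q? (k * m + a))) + ∑ n Q̅ ∎))
    where
    open ≤-Reasoning
    Q̅ : ℕ → ℕ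
    Q̅ k = χ (¬? (Q? (k * m + a)))
    total : ∀ (τ : ℕ → ℕ) → (∑[ k < n ] χ (Q? (τ k))) + (∑[ k < n ] χ (¬? (Q? (τ k)))) ≡ n * 1
    total τ = trans (sym (∑-+ n _ _)) (trans (∑-cong n (λ {k} _ → χ-¬ (Q? (τ k)))) (∑-const n 1))

  -- Write a residue modulo `n * m` as `k * m + a`. Then `P` depends on `a` only, and for each `a`
  -- the values `k * m + a` run through all residues modulo `n`, so `Q` holds for the same number of
  -- `k`.
  count-× : count (λ i → P? i ×-dec Q? i) (n * m) ≡ count P? m * count Q? n
  count-× = begin
    count (λ i → P? i ×-dec Q? i) (n * m)
      ≡⟨ ∑-blocks n m _ ⟩
    (∑[ k < n ] ∑[ a < m ] χ (P? (k * m + a) ×-dec Q? (k * m + a)))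
      ≡⟨ ∑-cong n (λ {k} _ → ∑-cong m λ {a} _ → trans (χ-× (P? _) (Q? _)) (cong (_* _) (χ-periodic P? perP k a))) ⟩
    (∑[ k < n ] ∑[ a < m ] χ (P? a) * χ (Q? (k * m + a)))
      ≡⟨ ∑-swap n m _ ⟩
    (∑[ a < m ] ∑[ k < n ] χ (P? a) * χ (Q? (k * m + a)))
      ≡⟨ ∑-cong m (λ {a} _ → trans (∑-*ˡ n (χ (P? a)) _) (cong (χ (P? a) *_) (progression-count a))) ⟩
    (∑[ a < m ] χ (P? a) * count Q? n)
      ≡⟨ ∑-*ʳ m (count Q? n) _ ⟩
    count P? m * count Q? n
      ∎
    where open ≡-Reasoning

-- Roots of x⁴ + 2 modulo p²

-- `f` is even and positive on all integers, so its values are those of `g` at absolute values, and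
-- divisibility can be studied in ℕ.
g : ℕ → ℕ
g x = x ^ 4 + 2

+-^ : ∀ x n → (+ x) ℤ.^ n ≡ + (x ^ n)
+-^ x zero    = refl
+-^ x (suc n) = trans (cong (+ x ℤ.*_) (+-^ x n)) (sym (ℤ.pos-* x (x ^ n)))

f≡g : ∀ d → f d ≡ + g ℤ.∣ d ∣
f≡g (+ x)      = cong (ℤ._+ + 2) (+-^ x 4)
f≡g (-[1+ x ]) = trans (even (+ suc x)) (f≡g (+ suc x))
  where
  open ℤ.+-*-Solver
  even : ∀ x → f (ℤ.- x) ≡ f x
  even = solve 1 (λ x → :- x :* (:- x :* (:- x :* (:- x :* con (+ 1)))) :+ con (+ 2) :=
                        x :* (x :* (x :* (x :* con (+ 1)))) :+ con (+ 2)) refl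

∣f∣≡g : ∀ d → ℤ.∣ f d ∣ ≡ g ℤ.∣ d ∣
∣f∣≡g d = cong ℤ.∣_∣ (f≡g d)

p∣p² : ∀ p → p ∣ p ^ 2
p∣p² p = m∣m*n (p * 1)

-- Euclid's lemma twice: first to write `x` as `k * p`, then to find a second factor `p` in `k`
-- after cancelling the first.
prime²-cancel : ∀ {p x y} → Prime p → ¬ p ∣ y → p ^ 2 ∣ x * y → p ^ 2 ∣ x
prime²-cancel {p} {x} {y} pr p∤y p²∣xy with euclidsLemma x y pr (∣-trans (p∣p² p) p²∣xy)
... | inj₂ p∣y              = contradiction p∣y p∤y
... | inj₁ (divides k refl) with euclidsLemma k y pr
        (*-cancelˡ-∣ p {{prime⇒nonZero pr}} (subst₂ _∣_ (cong (p *_) (*-identityʳ p)) rearrange p²∣xy))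
  where
  rearrange : k * p * y ≡ p * (k * y)
  rearrange = trans (cong (_* y) (*-comm k p)) (*-assoc p k y)
...   | inj₁ p∣k = subst (_∣ k * p) (cong (p *_) (sym (*-identityʳ p))) (*-monoˡ-∣ p p∣k)
...   | inj₂ p∣y = contradiction p∣y p∤y

-- A prime square can only be shared between two factors if `p` divides both. This replaces Hensel
-- lifting: roots modulo p² are counted through factorisations.
prime²-split : ∀ {p x y} → Prime p → ¬ (p ∣ x × p ∣ y) → p ^ 2 ∣ x * y → p ^ 2 ∣ x ⊎ p ^ 2 ∣ y
prime²-split {p} {x} {y} pr ¬both p²∣xy with p ∣? y
... | no p∤y  = inj₁ (prime²-cancel pr p∤y p²∣xy)
... | yes p∣y = inj₂ (prime²-cancel pr (λ p∣x → ¬both (p∣x , p∣y)) (subst (p ^ 2 ∣_) (*-comm x y) p²∣xy))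

ℤ-split : ∀ {p} x y → Prime p → ¬ (+ p ℤ.∣ x × + p ℤ.∣ y) →
          + (p ^ 2) ℤ.∣ x ℤ.* y → + (p ^ 2) ℤ.∣ x ⊎ + (p ^ 2) ℤ.∣ y
ℤ-split {p} x y pr ¬both p²∣xy = Sum.map ℤ.∣ᵤ⇒∣ ℤ.∣ᵤ⇒∣
  (prime²-split pr (λ (p∣x , p∣y) → ¬both (ℤ.∣ᵤ⇒∣ p∣x , ℤ.∣ᵤ⇒∣ p∣y))
    (subst (p ^ 2 ∣_) (ℤ.abs-* x y) (ℤ.∣⇒∣ᵤ p²∣xy)))

module OddPrime {p : ℕ} (pr : Prime p) (p∤2 : ¬ p ∣ 2) where

  q : ℕ
  q = p ^ 2

  ℤ-euclid : ∀ x y → + p ℤ.∣ x ℤ.* y → + p ℤ.∣ x ⊎ + p ℤ.∣ y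
  ℤ-euclid x y p∣xy = Sum.map ℤ.∣ᵤ⇒∣ ℤ.∣ᵤ⇒∣
    (euclidsLemma ℤ.∣ x ∣ ℤ.∣ y ∣ pr (subst (p ∣_) (ℤ.abs-* x y) (ℤ.∣⇒∣ᵤ p∣xy)))

  p∤2x : ∀ x → ¬ + p ℤ.∣ x → ¬ + p ℤ.∣ + 2 ℤ.* x
  p∤2x x p∤x p∣2x with ℤ-euclid (+ 2) x p∣2x
  ... | inj₁ p∣2 = p∤2 (ℤ.∣⇒∣ᵤ p∣2)
  ... | inj₂ p∣x = p∤x p∣x

  p∤x² : ∀ x → ¬ + p ℤ.∣ x → ¬ + p ℤ.∣ x ℤ.* x
  p∤x² x p∤x p∣x² with ℤ-euclid x x p∣x²
  ... | inj₁ p∣x = p∤x p∣x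
  ... | inj₂ p∣x = p∤x p∣x

  open ℤ.+-*-Solver

  ℤ-squares : ∀ a c → ¬ + p ℤ.∣ a → + q ℤ.∣ (a ℤ.- c) ℤ.* (a ℤ.+ c) → + q ℤ.∣ a ℤ.- c ⊎ + q ℤ.∣ a ℤ.+ c
  ℤ-squares a c p∤a = ℤ-split _ _ pr λ (x , y) →
    p∤2x a p∤a (subst (+ p ℤ.∣_) (sum a c) (ℤ.∣m∣n⇒∣m+n x y))
    where
    sum : ∀ a c → (a ℤ.- c) ℤ.+ (a ℤ.+ c) ≡ + 2 ℤ.* a
    sum = solve 2 (λ a c → (a :- c) :+ (a :+ c) := con (+ 2) :* a) refl

  -- Applied to two roots, whose difference of values is a⁴ - c⁴ = (a - c)(a + c)(a² + c²). If `p`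
  -- divided two of these factors, it would divide 2a or 2a², hence `a`, as `p` is odd. So p²
  -- divides a single factor: c is ± a, or c² is - a².
  ℤ-fourths : ∀ a c → ¬ + p ℤ.∣ a →
    + q ℤ.∣ ((a ℤ.- c) ℤ.* (a ℤ.+ c)) ℤ.* (a ℤ.* a ℤ.+ c ℤ.* c) →
    (+ q ℤ.∣ a ℤ.- c ⊎ + q ℤ.∣ a ℤ.+ c) ⊎ + q ℤ.∣ a ℤ.* a ℤ.+ c ℤ.* c
  ℤ-fourths a c p∤a = Sum.map₁ (ℤ-squares a c p∤a) ∘ ℤ-split _ _ pr λ (x , y) →
    p∤2x (a ℤ.* a) (p∤x² a p∤a) (subst (+ p ℤ.∣_) (sum a c) (ℤ.∣m∣n⇒∣m+n x y))
    where
    sum : ∀ a c → ((a ℤ.- c) ℤ.* (a ℤ.+ c)) ℤ.+ (a ℤ.* a ℤ.+ c ℤ.* c) ≡ + 2 ℤ.* (a ℤ.* a)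
    sum = solve 2 (λ a c → ((a :- c) :* (a :+ c)) :+ (a :* a :+ c :* c) := con (+ 2) :* (a :* a)) refl

  root⇒p∤ : ∀ {a} → q ∣ g a → ¬ p ∣ a
  root⇒p∤ {a} q∣ga p∣a = p∤2 (∣m+n∣m⇒∣n (∣-trans (p∣p² p) q∣ga) (∣m⇒∣m*n (a ^ 3) p∣a))

  Root : ℕ → Set
  Root a = a < q × q ∣ g a

  root⇒ℤ∤ : ∀ {a} → Root a → ¬ + p ℤ.∣ + a
  root⇒ℤ∤ (_ , q∣ga) p∣a = root⇒p∤ q∣ga (ℤ.∣⇒∣ᵤ p∣a)

  gap⇒≡ : ∀ {a c} → a ≤ c → c < q → q ∣ c ∸ a → a ≡ c
  gap⇒≡ {a} {c} a≤c c<q q∣c∸a with c ∸ a in eq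
  ... | zero  = ≤-antisym a≤c (m∸n≡0⇒m≤n eq)
  ... | suc _ = contradiction q∣c∸a (>⇒∤ (subst (_< q) eq (≤-<-trans (m∸n≤m c a) c<q)))

  minus⇒≡ : ∀ {a c} → a < q → c < q → + q ℤ.∣ + a ℤ.- + c → c ≡ a
  minus⇒≡ {a} {c} a<q c<q q∣ with ≤-total a c | subst (q ∣_) (cong ℤ.∣_∣ (ℤ.[+m]-[+n]≡m⊖n a c)) (ℤ.∣⇒∣ᵤ q∣)
  ... | inj₁ a≤c | q∣⊖ = sym (gap⇒≡ a≤c c<q (subst (q ∣_) (ℤ.∣⊖∣-≤ a≤c) q∣⊖))
  ... | inj₂ c≤a | q∣⊖ = gap⇒≡ c≤a a<q (subst (q ∣_) (trans (ℤ.∣m⊖n∣≡∣n⊖m∣ a c) (ℤ.∣⊖∣-≤ c≤a)) q∣⊖)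

  -- The sum `a + c` lies strictly between 0 and `2 * q`, so the quotient can only be 1.
  plus⇒≡ : ∀ {a c} → a < q → c < q → 0 < a → + q ℤ.∣ + a ℤ.+ + c → c ≡ q ∸ a
  plus⇒≡ {a} {c} a<q c<q 0<a q∣ with ℤ.∣⇒∣ᵤ q∣
  ... | divides zero          eq = contradiction (subst (0 <_) eq (≤-trans 0<a (m≤m+n a c))) λ ()
  ... | divides (suc zero)    eq = sym (trans (cong (_∸ a) (sym (trans eq (+-identityʳ q)))) (m+n∸m≡n a c))
  ... | divides (suc (suc k)) eq = contradiction (+-mono-< a<q c<q) (≤⇒≯ (begin
      q + q               ≤⟨ +-monoʳ-≤ q (m≤m+n q (k * q)) ⟩
      q + (q + k * q)     ≡⟨ eq ⟨
      a + c               ∎))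
    where open ≤-Reasoning

  root-pos : ∀ {a} → Root a → 0 < a
  root-pos {zero}  (_ , q∣2) = contradiction (∣-trans (p∣p² p) q∣2) p∤2
  root-pos {suc a} _ = s≤s z≤n

  ±⇒≡ : ∀ {a c} → Root a → c < q → + q ℤ.∣ + a ℤ.- + c ⊎ + q ℤ.∣ + a ℤ.+ + c → c ≡ a ⊎ c ≡ q ∸ a
  ±⇒≡ r c<q = Sum.map (minus⇒≡ (proj₁ r) c<q) (plus⇒≡ (proj₁ r) c<q (root-pos r))

  root-cases : ∀ {a c} → Root a → Root c →
               (c ≡ a ⊎ c ≡ q ∸ a) ⊎ + q ℤ.∣ + a ℤ.* + a ℤ.+ + c ℤ.* + c
  root-cases {a} {c} ra rc = Sum.map₁ (±⇒≡ ra (proj₁ rc)) (ℤ-fourths (+ a) (+ c) (root⇒ℤ∤ ra)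
    (subst (+ q ℤ.∣_) (trans (cong₂ ℤ._-_ (sym (f≡g (+ a))) (sym (f≡g (+ c)))) (factor (+ a) (+ c)))
      (ℤ.∣m∣n⇒∣m-n {m = + g a} {n = + g c} (ℤ.∣ᵤ⇒∣ (proj₂ ra)) (ℤ.∣ᵤ⇒∣ (proj₂ rc)))))
    where
    factor : ∀ a c → f a ℤ.- f c ≡ ((a ℤ.- c) ℤ.* (a ℤ.+ c)) ℤ.* (a ℤ.* a ℤ.+ c ℤ.* c)
    factor = solve 2 (λ a c → (a :* (a :* (a :* (a :* con (+ 1)))) :+ con (+ 2)) :-
                              (c :* (c :* (c :* (c :* con (+ 1)))) :+ con (+ 2)) :=
                              ((a :- c) :* (a :+ c)) :* (a :* a :+ c :* c)) refl

  -- Two roots whose squares are both ≡ - a² have congruent squares, hence agree up to sign.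
  imaginary-cases : ∀ {a b c} → Root b → Root c → + q ℤ.∣ + a ℤ.* + a ℤ.+ + b ℤ.* + b →
                    + q ℤ.∣ + a ℤ.* + a ℤ.+ + c ℤ.* + c → c ≡ b ⊎ c ≡ q ∸ b
  imaginary-cases {a} {b} {c} rb rc ab ac = ±⇒≡ rb (proj₁ rc) (ℤ-squares (+ b) (+ c) (root⇒ℤ∤ rb)
    (subst (+ q ℤ.∣_) (factor (+ a) (+ b) (+ c)) (ℤ.∣m∣n⇒∣m-n ab ac)))
    where
    factor : ∀ a b c → (a ℤ.* a ℤ.+ b ℤ.* b) ℤ.- (a ℤ.* a ℤ.+ c ℤ.* c) ≡ (b ℤ.- c) ℤ.* (b ℤ.+ c)
    factor = solve 3 (λ a b c → (a :* a :+ b :* b) :- (a :* a :+ c :* c) := (b :- c) :* (b :+ c)) refl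

  Imaginary : ℕ → ℕ → Set
  Imaginary a b = + q ℤ.∣ + a ℤ.* + a ℤ.+ + b ℤ.* + b

  -- One search for a root b with b² ≡ - a² decides everything. If it succeeds, the roots are among
  -- ± a, ± b; if not, among ± a, which then fill the four slots twice.
  roots-from : ∀ {a} → Root a → Dec (∃ λ b → b < q × (q ∣ g b × Imaginary a b)) →
               count (λ c → q ∣? g c) q ≤ 4
  roots-from {a} ra (yes (b , b<q , q∣gb , ab)) = count-≤4 (λ c → q ∣? g c) q a (q ∸ a) b (q ∸ b)
    λ c<q q∣gc → Sum.map₂ (imaginary-cases {a} (b<q , q∣gb) (c<q , q∣gc) ab) (root-cases ra (c<q , q∣gc))
  roots-from {a} ra (no none) = count-≤4 (λ c → q ∣? g c) q a (q ∸ a) a (q ∸ a)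
    λ {c} c<q q∣gc → Sum.map₂ (λ ac → contradiction (c , c<q , q∣gc , ac) none) (root-cases ra (c<q , q∣gc))

  imaginary? : ∀ a b → Dec (q ∣ g b × Imaginary a b)
  imaginary? a b = (q ∣? g b) ×-dec (+ q ℤ.∣? + a ℤ.* + a ℤ.+ + b ℤ.* + b)

  roots-≤4 : count (λ a → q ∣? g a) q ≤ 4
  roots-≤4 = go (anyUpTo? (λ a → q ∣? g a) q)
    where
    go : Dec (∃ λ a → a < q × q ∣ g a) → count (λ a → q ∣? g a) q ≤ 4
    go (yes (a , ra)) = roots-from ra (anyUpTo? (imaginary? a) q)
    go (no none)      = count-≤4 (λ a → q ∣? g a) q 0 0 0 0
      λ {c} c<q q∣gc → contradiction (c , c<q , q∣gc) none

δ≡count : ∀ q → δ f q ≡ count (λ a → q ∣? g a) q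
δ≡count q = trans (count-length (λ a → q ∣? ℤ.∣ f (+ a) ∣) q)
  (∑-cong q λ {a} _ → cong (λ m → χ (q ∣? m)) (∣f∣≡g (+ a)))

δ≤4 : ∀ {p} → Prime p → δ f (p ^ 2) ≤ 4
δ≤4 {p} pr with p ≟ 2
-- `δ f 4` evaluates to 0: a fourth power is 0 or 1 modulo 4, so `f` takes only the residues 2 and
-- 3.
... | yes refl = z≤n
... | no p≢2   = subst (_≤ 4) (sym (δ≡count (p ^ 2))) (OddPrime.roots-≤4 pr p∤2)
  where
  p∤2 : ¬ p ∣ 2
  p∤2 p∣2 with prime⇒irreducible prime[2] p∣2
  ... | inj₁ refl = ¬prime[1] pr
  ... | inj₂ p≡2  = p≢2 p≡2

g-periodic : ∀ q k i → q ∣ g (k * q + i) ⇔ q ∣ g i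
g-periodic q k i = mk⇔
  (λ q∣ → ∣m+n∣m⇒∣n (subst (q ∣_) (trans expand (+-comm (g i) _)) q∣) (∣m⇒∣m*n s (n∣m*n k)))
  (λ q∣ → subst (q ∣_) (sym expand) (∣m∣n⇒∣m+n q∣ (∣m⇒∣m*n s (n∣m*n k))))
  where
  open +-*-Solver
  -- The cofactor in x⁴ - i⁴ = (x - i)(x³ + x²i + xi² + i³), where x - i is `k * q`.
  s : ℕ
  s = let x = k * q + i in x * (x * x) + x * x * i + (x * (i * i) + i * (i * i))
  expand : g (k * q + i) ≡ g i + k * q * s
  expand = solve 2 (λ y i → let x = y :+ i in
    x :* (x :* (x :* (x :* con 1))) :+ con 2 :=
    i :* (i :* (i :* (i :* con 1))) :+ con 2 :+
    y :* (x :* (x :* x) :+ x :* x :* i :+ (x :* (i :* i) :+ i :* (i :* i)))) refl (k * q) i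

g⁺-periodic : ∀ q → Periodic q (λ i → q ∣ g (suc i))
g⁺-periodic q k i = subst (λ x → q ∣ g x ⇔ q ∣ g (suc i)) (+-suc (k * q) i) (g-periodic q k (suc i))

-- The sieve sees the residues 1, ..., q, whereas `δ` counts over 0, ..., q - 1; the classes of 0
-- and q coincide.
count⁺≡δ : ∀ q → count (λ i → q ∣? g (suc i)) q ≡ δ f q
count⁺≡δ q = trans (∑-rotate q _ (χ-cong (q ∣? g q) (q ∣? g 0)
    (subst (λ x → q ∣ g x ⇔ q ∣ g 0) (trans (+-identityʳ (1 * q)) (+-identityʳ q)) (g-periodic q 1 0))))
  (sym (δ≡count q))

-- The sieve

-- Throughout the sieve the index i < N stands for d = i + 1, so that d runs over 1, …, N.
Avoids : ℕ → ℕ → Set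
Avoids z i = ∀ p → p < suc z → Prime p → ¬ p ^ 2 ∣ g (suc i)

avoids? : ∀ z → Decidable (Avoids z)
avoids? z i = map′ (λ av p → av {p}) (λ av {p} → av p)
  (allUpTo? (λ p → prime? p →-dec ¬? (p ^ 2 ∣? g (suc i))) (suc z))

avoids-suc : ∀ {z} → Prime (suc z) → ∀ i → Avoids (suc z) i ⇔ (Avoids z i × ¬ suc z ^ 2 ∣ g (suc i))
avoids-suc {z} pr i = mk⇔ (λ av → (λ p p<z → av p (m<n⇒m<1+n p<z)) , av (suc z) ≤-refl pr) from
  where
  from : Avoids z i × ¬ suc z ^ 2 ∣ g (suc i) → Avoids (suc z) i
  from (av , ¬q∣) p p≤z p-prime with m≤n⇒m<n∨m≡n (≤-pred p≤z)
  ... | inj₁ p<z  = av p p<z p-prime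
  ... | inj₂ refl = ¬q∣

avoids-skip : ∀ {z} → ¬ Prime (suc z) → ∀ i → Avoids (suc z) i ⇔ Avoids z i
avoids-skip {z} ¬pr i = mk⇔ (λ av p p<z → av p (m<n⇒m<1+n p<z)) from
  where
  from : Avoids z i → Avoids (suc z) i
  from av p p≤z p-prime with m≤n⇒m<n∨m≡n (≤-pred p≤z)
  ... | inj₁ p<z  = av p p<z p-prime
  ... | inj₂ refl = contradiction p-prime ¬pr

-- The recursion copies `primeProductUpTo`, so that `𝒫 z` becomes the fraction `survivors z` over
-- `period z` step by step.
period : ℕ → ℕ
period zero = 1
period (suc z) with prime? (suc z)
... | yes _ = suc z ^ 2 * period z
... | no _  = period z

period-suc : ∀ {z} → Prime (suc z) → period (suc z) ≡ suc z ^ 2 * period z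
period-suc {z} pr with prime? (suc z)
... | yes _  = refl
... | no ¬pr = contradiction pr ¬pr

period-skip : ∀ {z} → ¬ Prime (suc z) → period (suc z) ≡ period z
period-skip {z} ¬pr with prime? (suc z)
... | yes pr = contradiction pr ¬pr
... | no _   = refl

period-nonZero : ∀ z → NonZero (period z)
period-nonZero zero = _
period-nonZero (suc z) with prime? (suc z)
... | yes _ = m*n≢0 (suc z ^ 2) (period z) {{_}} {{period-nonZero z}}
... | no _  = period-nonZero z

prime∤period : ∀ {p} z → Prime p → z < p → ¬ p ∣ period z
prime∤period zero    pr z<p p∣1 = ¬prime[1] (subst Prime (∣1⇒≡1 p∣1) pr)
prime∤period {p} (suc z) pr z<p p∣M with prime? (suc z)
... | no _  = prime∤period z pr (<-trans (n<1+n z) z<p) p∣M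
... | yes _ with euclidsLemma (suc z ^ 2) (period z) pr p∣M
...   | inj₂ p∣period = prime∤period z pr (<-trans (n<1+n z) z<p) p∣period
...   | inj₁ p∣z²     with euclidsLemma (suc z) (suc z * 1) pr p∣z²
...     | inj₁ p∣z = <⇒≱ z<p (∣⇒≤ p∣z)
...     | inj₂ p∣z = <⇒≱ z<p (∣⇒≤ (subst (p ∣_) (*-identityʳ (suc z)) p∣z))

avoids-periodic : ∀ z → Periodic (period z) (Avoids z)
avoids-periodic zero k i = mk⇔ (λ _ → none {i}) (λ _ → none {k * 1 + i})
  where
  none : ∀ {i} → Avoids zero i
  none _ (s≤s z≤n) pr = contradiction pr ¬prime[0]
avoids-periodic (suc z) = go (prime? (suc z))
  where
  go : Dec (Prime (suc z)) → Periodic (period (suc z)) (Avoids (suc z))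
  go (yes pr) = subst (λ m → Periodic m (Avoids (suc z))) (sym (period-suc pr))
    (Periodic-⇔ (avoids-suc pr) (Periodic-× (avoids-periodic z) (Periodic-¬ (g⁺-periodic (suc z ^ 2)))))
  go (no ¬pr) = subst (λ m → Periodic m (Avoids (suc z))) (sym (period-skip ¬pr))
    (Periodic-⇔ (avoids-skip ¬pr) (avoids-periodic z))

survivors : ℕ → ℕ
survivors z = count (avoids? z) (period z)

nonroots : ℕ → ℕ
nonroots q = count (λ i → ¬? (q ∣? g (suc i))) q

δ+nonroots : ∀ q → δ f q + nonroots q ≡ q
δ+nonroots q = begin
  δ f q + nonroots q                                            ≡⟨ cong (_+ nonroots q) (count⁺≡δ q) ⟨
  count (λ i → q ∣? g (suc i)) q + nonroots q                   ≡⟨ ∑-+ q _ _ ⟨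
  (∑[ i < q ] χ (q ∣? g (suc i)) + χ (¬? (q ∣? g (suc i))))     ≡⟨ ∑-cong q (λ {i} _ → χ-¬ (q ∣? g (suc i))) ⟩
  (∑[ _ < q ] 1)                                                ≡⟨ trans (∑-const q 1) (*-identityʳ q) ⟩
  q                                                             ∎
  where open ≡-Reasoning

survivors-suc : ∀ {z} → Prime (suc z) → survivors (suc z) ≡ survivors z * nonroots (suc z ^ 2)
survivors-suc {z} pr = begin
  survivors (suc z)                                        ≡⟨ cong (count (avoids? (suc z))) (period-suc pr) ⟩
  count (avoids? (suc z)) (suc z ^ 2 * period z)           ≡⟨ count-cong (avoids? (suc z)) (λ i → avoids? z i ×-dec ¬? (suc z ^ 2 ∣? g (suc i))) (avoids-suc pr) (suc z ^ 2 * period z) ⟩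
  count (λ i → avoids? z i ×-dec ¬? (suc z ^ 2 ∣? g (suc i))) (suc z ^ 2 * period z)
    ≡⟨ ChineseRemainder.count-× (avoids? z) (λ i → ¬? (suc z ^ 2 ∣? g (suc i))) {n = suc z ^ 2}
         (avoids-periodic z) (Periodic-¬ (g⁺-periodic (suc z ^ 2)))
         (λ x → prime²-cancel pr (prime∤period z pr (n<1+n z))) ⟩
  survivors z * nonroots (suc z ^ 2)                       ∎
  where open ≡-Reasoning

survivors-skip : ∀ {z} → ¬ Prime (suc z) → survivors (suc z) ≡ survivors z
survivors-skip {z} ¬pr = trans (cong (count (avoids? (suc z))) (period-skip ¬pr))
  (count-cong (avoids? (suc z)) (avoids? z) (avoids-skip ¬pr) (period z))

SquareDivisor : ℕ → ℕ → Set
SquareDivisor i p = Prime p × p ^ 2 ∣ g (suc i)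

squareDivisor? : ∀ i → Decidable (SquareDivisor i)
squareDivisor? i p = prime? p ×-dec (p ^ 2 ∣? g (suc i))

g>0 : ∀ x → 0 < g x
g>0 x = ≤-trans (s≤s z≤n) (m≤n+m 2 (x ^ 4))

g-mono : ∀ {x y} → x ≤ y → g x ≤ g y
g-mono x≤y = +-monoˡ-≤ 2 (^-monoˡ-≤ 4 x≤y)

squareDivisor-≤ : ∀ {i p} → SquareDivisor i p → p ≤ g (suc i)
squareDivisor-≤ {i} {p} (_ , p²∣) = ∣⇒≤ {{>-nonZero (g>0 (suc i))}} (∣-trans (p∣p² p) p²∣)

-- The bound on `p` makes the search finite and loses nothing: a `p` whose square divides the
-- positive number `g (suc i)` is at most that number.
HasSquare : ℕ → Set
HasSquare i = ∃ λ p → p < suc (g (suc i)) × SquareDivisor i p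

hasSquare? : Decidable HasSquare
hasSquare? i = anyUpTo? (squareDivisor? i) (suc (g (suc i)))

squareFree? : Decidable (¬_ ∘ HasSquare)
squareFree? i = ¬? (hasSquare? i)

prime-divisor : ∀ m → ∃ λ p → Prime p × p ∣ suc (suc m)
prime-divisor m with factorise (suc (suc m))
... | record { factors = p ∷ ps ; isFactorisation = eq ; factorsPrime = pr ∷ _ } =
  p , pr , subst (p ∣_) (sym eq) (m∣m*n (product ps))

-- A divisor `d` in `Squarefree` is an arbitrary integer. If its absolute value is at least 2, it
-- has a prime factor, whose square also divides the value; `d = 0` is impossible because the value
-- is positive.
squareFree⇔ : ∀ i → (¬ HasSquare i) ⇔ Squarefree (f (+ suc i))
squareFree⇔ i = mk⇔ to from
  where
  to : ¬ HasSquare i → Squarefree (f (+ suc i))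
  to ¬sq d d²∣f = go ℤ.∣ d ∣ (subst₂ _∣_ (ℤ.abs-* d d) (∣f∣≡g (+ suc i)) d²∣f)
    where
    go : ∀ m → m * m ∣ g (suc i) → m ≡ 1
    go zero    0∣g  = contradiction (0∣⇒≡0 0∣g) (>⇒≢ (g>0 (suc i)))
    go (suc zero) _ = refl
    go (suc (suc m)) m²∣g with prime-divisor m
    ... | p , pr , p∣m = contradiction (p , s≤s (squareDivisor-≤ {i} sq) , sq) ¬sq
      where
      sq : SquareDivisor i p
      sq = pr , ∣-trans (*-pres-∣ p∣m (subst (_∣ suc (suc m)) (sym (*-identityʳ p)) p∣m)) m²∣g
  from : Squarefree (f (+ suc i)) → ¬ HasSquare i
  from sf (p , _ , pr , p²∣g) = ¬prime[1] (subst Prime (sf (+ p) p²∣f) pr)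
    where
    p²∣f : ℤ.∣ + p ℤ.* + p ∣ ∣ ℤ.∣ f (+ suc i) ∣
    p²∣f = subst₂ _∣_ (trans (cong (p *_) (*-identityʳ p)) (sym (ℤ.abs-* (+ p) (+ p))))
                      (sym (∣f∣≡g (+ suc i))) p²∣g

squareFree-card : ∀ N → HasCard (λ d → 1 ≤ d × d ≤ N × Squarefree (f (+ d))) (count squareFree? N)
squareFree-card N = map suc xs , Unique.map⁺ suc-injective (Unique.filter⁺ squareFree? (Unique.upTo⁺ N)) ,
                    (λ d → mk⇔ to from) , trans (length-map suc xs) (count-length squareFree? N)
  where
  xs = filter squareFree? (upTo N)
  to : ∀ {d} → d ∈ map suc xs → 1 ≤ d × d ≤ N × Squarefree (f (+ d))
  to d∈ with ∈-map⁻ suc d∈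
  ... | i , i∈ , refl with ∈-filter⁻ squareFree? {xs = upTo N} i∈
  ...   | i∈N , sf = s≤s z≤n , ∈-upTo⁻ i∈N , Equivalence.to (squareFree⇔ i) sf
  from : ∀ {d} → 1 ≤ d × d ≤ N × Squarefree (f (+ d)) → d ∈ map suc xs
  from {suc i} (_ , i<N , sf) =
    ∈-map⁺ suc (∈-filter⁺ squareFree? (∈-upTo⁺ i<N) (Equivalence.from (squareFree⇔ i) sf))

-- A decidable form of membership in S²(f, N). Only d in 1, ..., N are searched, since 0 is never a
-- root modulo p²: f(0) = 2 < 4 ≤ p².
Reached : ℕ → ℕ → Set
Reached N p = Prime p × ∃ λ i → i < N × p ^ 2 ∣ g (suc i)

reached? : ∀ N → Decidable (Reached N)
reached? N p = prime? p ×-dec anyUpTo? (λ i → p ^ 2 ∣? g (suc i)) N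

reached-≤ : ∀ {N p} → Reached N p → p ≤ g N
reached-≤ (pr , i , i<N , p²∣) = ≤-trans (squareDivisor-≤ {i} (pr , p²∣)) (g-mono i<N)

/-telescope : ∀ N z .{{_ : NonZero z}} → N / (suc z ^ 2) + N / suc z ≤ N / z
/-telescope N z = subst (_≤ N / z) (m*n/n≡m (a + b) z) (/-monoˡ-≤ z (*-cancelʳ-≤ _ _ (suc z ^ 2) (begin
  (a + b) * z * w ^ 2                      ≡⟨ solve 4 (λ a b z w → (a :+ b) :* z :* (w :* (w :* con 1)) := a :* (w :* (w :* con 1)) :* z :+ b :* w :* (w :* z)) refl a b z w ⟩
  a * w ^ 2 * z + b * w * (w * z)          ≤⟨ +-mono-≤ (*-monoˡ-≤ z (m/n*n≤m N (w ^ 2))) (*-monoˡ-≤ (w * z) (m/n*n≤m N w)) ⟩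
  N * z + N * (w * z)                      ≤⟨ m≤m+n _ N ⟩
  N * z + N * (w * z) + N                  ≡⟨ solve 2 (λ n z → let w = con 1 :+ z in n :* z :+ n :* (w :* z) :+ n := n :* (w :* (w :* con 1))) refl N z ⟩
  N * w ^ 2                                ∎)))
  where
  open ≤-Reasoning
  open +-*-Solver
  w = suc z
  a = N / (w ^ 2)
  b = N / w

∑-/-squares : ∀ W N z .{{_ : NonZero z}} → (∑[ j < W ] N / ((suc z + j) ^ 2)) ≤ N / z
∑-/-squares zero    N z = z≤n
∑-/-squares (suc W) N z = begin
  N / ((suc z + 0) ^ 2) + (∑[ j < W ] N / ((suc z + suc j) ^ 2))
    ≡⟨ cong₂ _+_ (cong (λ x → N / (suc x ^ 2)) (+-identityʳ z)) (∑-cong W λ {j} _ → cong (λ x → N / (suc x ^ 2)) (+-suc z j)) ⟩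
  N / (suc z ^ 2) + (∑[ j < W ] N / ((suc (suc z) + j) ^ 2))
    ≤⟨ +-monoʳ-≤ (N / (suc z ^ 2)) (∑-/-squares W N (suc z)) ⟩
  N / (suc z ^ 2) + N / suc z
    ≤⟨ /-telescope N z ⟩
  N / z ∎
  where open ≤-Reasoning

roots-count : ∀ {p} → Prime (suc p) → ∀ N → count (λ i → suc p ^ 2 ∣? g (suc i)) N ≤ 4 * (1 + N / (suc p ^ 2))
roots-count {p} pr N = begin
  count (λ i → q ∣? g (suc i)) N                        ≤⟨ count-≤ (λ i → q ∣? g (suc i)) (g⁺-periodic q) N ⟩
  suc (N / q) * count (λ i → q ∣? g (suc i)) q          ≡⟨ cong (suc (N / q) *_) (count⁺≡δ q) ⟩
  suc (N / q) * δ f q                                   ≤⟨ *-monoʳ-≤ (suc (N / q)) (δ≤4 pr) ⟩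
  suc (N / q) * 4                                       ≡⟨ *-comm (suc (N / q)) 4 ⟩
  4 * (1 + N / q)                                       ∎
  where
  open ≤-Reasoning
  q = suc p ^ 2

squareFree≤avoids : ∀ z N → count squareFree? N ≤ count (avoids? z) N
squareFree≤avoids z N = ∑-mono N λ {i} _ → χ-mono (squareFree? i) (avoids? z i)
  λ ¬sq p _ pr p²∣ → ¬sq (p , s≤s (squareDivisor-≤ {i} (pr , p²∣)) , pr , p²∣)

-- Every reached prime is at most `g N`, so any range beyond that lists all of S²(f, N), whatever
-- `z` is. The summand `suc z` lets the range be cut just above `z`.
bound : ℕ → ℕ → ℕ
bound N z = suc z + suc (g N)

reachedCount : ℕ → ℕ → ℕ
reachedCount N z = count (reached? N) (bound N z)

-- A value with no square divisor up to z that is not square-free has a square divisor p² with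
-- z < p, and p is then one of the primes in S²(f, N).
avoids≤ : ∀ z N {i} → i < N → χ (avoids? z i) ≤
          χ (squareFree? i) + (∑[ j < suc (g N) ] χ (reached? N (suc z + j)) * χ ((suc z + j) ^ 2 ∣? g (suc i)))
avoids≤ z N {i} i<N = χ≤ (avoids? z i) λ av → go av (hasSquare? i)
  where
  term : ℕ → ℕ
  term j = χ (reached? N (suc z + j)) * χ ((suc z + j) ^ 2 ∣? g (suc i))
  go : Avoids z i → Dec (HasSquare i) → 1 ≤ χ (squareFree? i) + (∑[ j < suc (g N) ] term j)
  go av (no ¬sq) = ≤-trans (≤-reflexive (sym (χ-yes (squareFree? i) ¬sq))) (m≤m+n _ _)
  go av (yes (p , _ , pr , p²∣)) with p <? suc z
  ... | yes p≤z = contradiction p²∣ (av p p≤z pr)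
  ... | no  p≰z = begin
    1                                                     ≡⟨ sym one ⟩
    term (p ∸ suc z)                                      ≤⟨ ∑-term term (s≤s (≤-trans (m∸n≤m p (suc z)) (reached-≤ r))) ⟩
    (∑[ j < suc (g N) ] term j)                           ≤⟨ m≤n+m _ (χ (squareFree? i)) ⟩
    χ (squareFree? i) + (∑[ j < suc (g N) ] term j)       ∎
    where
    open ≤-Reasoning
    r : Reached N p
    r = pr , i , i<N , p²∣
    one : term (p ∸ suc z) ≡ 1
    one = trans (cong (λ x → χ (reached? N x) * χ (x ^ 2 ∣? g (suc i))) (m+[n∸m]≡n (≮⇒≥ p≰z)))
                (cong₂ _*_ (χ-yes (reached? N p) r) (χ-yes (p ^ 2 ∣? g (suc i)) p²∣))

-- After exchanging the sums, each p > z contributes its number of hits d, weighted by `s j`. The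
-- weight removes unreached p and thereby keeps the rounding term 1 for reached primes only. The
-- terms N/p² are kept for all integers p > z, where they telescope.
avoids≤squareFree : ∀ z N .{{_ : NonZero z}} →
  count (avoids? z) N ≤ count squareFree? N + 4 * (reachedCount N z + N / z)
avoids≤squareFree z N = begin
  count (avoids? z) N
    ≤⟨ ∑-mono N (avoids≤ z N) ⟩
  (∑[ i < N ] χ (squareFree? i) + (∑[ j < W ] s j * hit j i))
    ≡⟨ ∑-+ N (χ ∘ squareFree?) (λ i → ∑[ j < W ] s j * hit j i) ⟩
  count squareFree? N + (∑[ i < N ] ∑[ j < W ] s j * hit j i)
    ≡⟨ cong (_+_ (count squareFree? N)) (trans (∑-swap N W (λ i j → s j * hit j i)) (∑-cong W λ {j} _ → ∑-*ˡ N (s j) (hit j))) ⟩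
  count squareFree? N + (∑[ j < W ] s j * ∑ N (hit j))
    ≤⟨ +-monoʳ-≤ (count squareFree? N) (∑-mono W λ {j} _ → step j (reached? N (suc z + j))) ⟩
  count squareFree? N + (∑[ j < W ] 4 * (s j + t j))
    ≡⟨ cong (_+_ (count squareFree? N)) (trans (∑-*ˡ W 4 (λ j → s j + t j)) (cong (4 *_) (∑-+ W s t))) ⟩
  count squareFree? N + 4 * (∑ W s + ∑ W t)
    ≤⟨ +-monoʳ-≤ (count squareFree? N) (*-monoʳ-≤ 4 (+-mono-≤ tail (∑-/-squares W N z))) ⟩
  count squareFree? N + 4 * (reachedCount N z + N / z) ∎
  where
  open ≤-Reasoning
  W = suc (g N)
  s : ℕ → ℕ
  s j = χ (reached? N (suc z + j))
  t : ℕ → ℕ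
  t j = N / (suc (z + j) ^ 2)
  hit : ℕ → ℕ → ℕ
  hit j i = χ (suc (z + j) ^ 2 ∣? g (suc i))
  tail : ∑ W s ≤ reachedCount N z
  tail = ≤-trans (m≤n+m (∑ W s) (count (reached? N) (suc z))) (≤-reflexive (sym (∑-split (suc z) W (λ p → χ (reached? N p)))))
  step : ∀ j (r : Dec (Reached N (suc z + j))) →
         χ r * count (λ i → suc (z + j) ^ 2 ∣? g (suc i)) N ≤ 4 * (χ r + N / (suc (z + j) ^ 2))
  step j (no _)         = z≤n
  step j (yes (pr , _)) = ≤-trans (≤-reflexive (+-identityʳ _)) (roots-count pr N)

-- Rational and real estimates

ι : ℕ → ℚ
ι n = + n ℚ./ 1

toℚᵘ-/ : ∀ a q .{{_ : NonZero q}} → ℚ.toℚᵘ (+ a ℚ./ q) ℚᵘ.≃ (+ a ℚᵘ./ q)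
toℚᵘ-/ a (suc q) = ℚ.toℚᵘ-fromℚᵘ (mkℚᵘ (+ a) q)

ι-+ : ∀ m n → ι (m + n) ≡ ι m ℚ.+ ι n
ι-+ m n = ℚ.toℚᵘ-injective (begin
  ℚ.toℚᵘ (ι (m + n))                   ≈⟨ toℚᵘ-/ (m + n) 1 ⟩
  mkℚᵘ (+ (m + n)) 0                   ≈⟨ ℚᵘ.*≡* (cong (ℤ._* + 1) (cong₂ ℤ._+_ (sym (ℤ.*-identityʳ (+ m))) (sym (ℤ.*-identityʳ (+ n))))) ⟩
  mkℚᵘ (+ m) 0 ℚᵘ.+ mkℚᵘ (+ n) 0       ≈⟨ ℚᵘ.+-cong (toℚᵘ-/ m 1) (toℚᵘ-/ n 1) ⟨
  ℚ.toℚᵘ (ι m) ℚᵘ.+ ℚ.toℚᵘ (ι n)       ≈⟨ ℚ.toℚᵘ-homo-+ (ι m) (ι n) ⟨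
  ℚ.toℚᵘ (ι m ℚ.+ ι n)                 ∎)
  where open ℚᵘ.≃-Reasoning

ι-* : ∀ m n → ι (m * n) ≡ ι m ℚ.* ι n
ι-* m n = ℚ.toℚᵘ-injective (begin
  ℚ.toℚᵘ (ι (m * n))                   ≈⟨ toℚᵘ-/ (m * n) 1 ⟩
  mkℚᵘ (+ (m * n)) 0                   ≈⟨ ℚᵘ.*≡* (cong (ℤ._* + 1) (ℤ.pos-* m n)) ⟩
  mkℚᵘ (+ m) 0 ℚᵘ.* mkℚᵘ (+ n) 0       ≈⟨ ℚᵘ.*-cong (toℚᵘ-/ m 1) (toℚᵘ-/ n 1) ⟨
  ℚ.toℚᵘ (ι m) ℚᵘ.* ℚ.toℚᵘ (ι n)       ≈⟨ ℚ.toℚᵘ-homo-* (ι m) (ι n) ⟨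
  ℚ.toℚᵘ (ι m ℚ.* ι n)                 ∎)
  where open ℚᵘ.≃-Reasoning

ι-mono : ∀ {m n} → m ≤ n → ι m ℚ.≤ ι n
ι-mono {m} {n} m≤n = ℚ.toℚᵘ-cancel-≤ (begin
  ℚ.toℚᵘ (ι m)   ≃⟨ toℚᵘ-/ m 1 ⟩
  mkℚᵘ (+ m) 0   ≤⟨ ℚᵘ.*≤* (ℤ.*-monoʳ-≤-nonNeg (+ 1) (ℤ.+≤+ m≤n)) ⟩
  mkℚᵘ (+ n) 0   ≃⟨ toℚᵘ-/ n 1 ⟨
  ℚ.toℚᵘ (ι n)   ∎)
  where open ℚᵘ.≤-Reasoning

ι-cancel : ∀ {m n} → ι m ℚ.≤ ι n → m ≤ n
ι-cancel {m} {n} le = ℤ.drop‿+≤+ (subst₂ ℤ._≤_ (ℤ.*-identityʳ (+ m)) (ℤ.*-identityʳ (+ n)) (ℚᵘ.drop-*≤* (begin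
  mkℚᵘ (+ m) 0   ≃⟨ toℚᵘ-/ m 1 ⟨
  ℚ.toℚᵘ (ι m)   ≤⟨ ℚ.toℚᵘ-mono-≤ le ⟩
  ℚ.toℚᵘ (ι n)   ≃⟨ toℚᵘ-/ n 1 ⟩
  mkℚᵘ (+ n) 0   ∎)))
  where open ℚᵘ.≤-Reasoning

ι-pos : ∀ n .{{_ : NonZero n}} → ℚ.Positive (ι n)
ι-pos n = ℚ.normalize-pos n 1

infix 4 _≐_÷_

-- The fraction a/m with its denominator cleared. It need not be in lowest terms, so sums and
-- products require no reduction, and `≐-≤` turns comparisons into inequalities in ℕ.
record _≐_÷_ (x : ℚ) (a m : ℕ) : Set where
  constructor ratio
  field cleared : x ℚ.* ι m ≡ ι a

open _≐_÷_

/-≐ : ∀ a q .{{_ : NonZero q}} → + a ℚ./ q ≐ a ÷ q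
/-≐ a q@(suc _) = ratio (ℚ.toℚᵘ-injective (begin
  ℚ.toℚᵘ (+ a ℚ./ q ℚ.* ι q)                   ≈⟨ ℚ.toℚᵘ-homo-* (+ a ℚ./ q) (ι q) ⟩
  ℚ.toℚᵘ (+ a ℚ./ q) ℚᵘ.* ℚ.toℚᵘ (ι q)         ≈⟨ ℚᵘ.*-cong (toℚᵘ-/ a q) (toℚᵘ-/ q 1) ⟩
  (+ a ℚᵘ./ q) ℚᵘ.* mkℚᵘ (+ q) 0               ≈⟨ ℚᵘ.*≡* (trans (ℤ.*-identityʳ _) (cong (λ k → + a ℤ.* + k) (sym (*-identityʳ q)))) ⟩
  mkℚᵘ (+ a) 0                                 ≈⟨ toℚᵘ-/ a 1 ⟨
  ℚ.toℚᵘ (ι a)                                 ∎))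
  where open ℚᵘ.≃-Reasoning

open ℚ.+-*-Solver using (solve; _:+_; _:*_; _:-_; :-_; _:=_; con)
module S = +-*-Solver

≐-+ : ∀ {x y a b m n} → x ≐ a ÷ m → y ≐ b ÷ n → x ℚ.+ y ≐ a * n + b * m ÷ m * n
≐-+ {x} {y} {a} {b} {m} {n} (ratio xa) (ratio yb) = ratio (begin
  (x ℚ.+ y) ℚ.* ι (m * n)                                    ≡⟨ cong ((x ℚ.+ y) ℚ.*_) (ι-* m n) ⟩
  (x ℚ.+ y) ℚ.* (ι m ℚ.* ι n)                                ≡⟨ solve 4 (λ x y m n → (x :+ y) :* (m :* n) := (x :* m) :* n :+ (y :* n) :* m) refl x y (ι m) (ι n) ⟩
  (x ℚ.* ι m) ℚ.* ι n ℚ.+ (y ℚ.* ι n) ℚ.* ι m                ≡⟨ cong₂ ℚ._+_ (cong (ℚ._* ι n) xa) (cong (ℚ._* ι m) yb) ⟩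
  ι a ℚ.* ι n ℚ.+ ι b ℚ.* ι m                                ≡⟨ cong₂ ℚ._+_ (ι-* a n) (ι-* b m) ⟨
  ι (a * n) ℚ.+ ι (b * m)                                    ≡⟨ ι-+ (a * n) (b * m) ⟨
  ι (a * n + b * m)                                          ∎)
  where open ≡-Reasoning

≐-* : ∀ {x y a b m n} → x ≐ a ÷ m → y ≐ b ÷ n → x ℚ.* y ≐ a * b ÷ n * m
≐-* {x} {y} {a} {b} {m} {n} (ratio xa) (ratio yb) = ratio (begin
  x ℚ.* y ℚ.* ι (n * m)                  ≡⟨ cong (x ℚ.* y ℚ.*_) (ι-* n m) ⟩
  x ℚ.* y ℚ.* (ι n ℚ.* ι m)              ≡⟨ exchange x y (ι n) (ι m) ⟩
  (x ℚ.* ι m) ℚ.* (y ℚ.* ι n)            ≡⟨ cong₂ ℚ._*_ xa yb ⟩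
  ι a ℚ.* ι b                            ≡⟨ ι-* a b ⟨
  ι (a * b)                              ∎)
  where
  open ≡-Reasoning
  exchange : ∀ x y n m → x ℚ.* y ℚ.* (n ℚ.* m) ≡ (x ℚ.* m) ℚ.* (y ℚ.* n)
  exchange = solve 4 (λ x y n m → x :* y :* (n :* m) := (x :* m) :* (y :* n)) refl

≐-complement : ∀ {x a b m} → x ≐ a ÷ m → a + b ≡ m → 1ℚ ℚ.- x ≐ b ÷ m
≐-complement {x} {a} {b} (ratio xa) refl = ratio (begin
  (1ℚ ℚ.- x) ℚ.* ι (a + b)               ≡⟨ expand x (ι (a + b)) ⟩
  ι (a + b) ℚ.- x ℚ.* ι (a + b)          ≡⟨ cong₂ ℚ._-_ (ι-+ a b) xa ⟩
  ι a ℚ.+ ι b ℚ.- ι a                    ≡⟨ cancel (ι a) (ι b) ⟩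
  ι b                                    ∎)
  where
  open ≡-Reasoning
  expand : ∀ x m → (1ℚ ℚ.- x) ℚ.* m ≡ m ℚ.- x ℚ.* m
  expand = solve 2 (λ x m → (con 1ℚ :- x) :* m := m :- x :* m) refl
  cancel : ∀ a b → a ℚ.+ b ℚ.- a ≡ b
  cancel = solve 2 (λ a b → a :+ b :- a := b) refl

≐-resp : ∀ {x y a b m n} → x ≡ y → a ≡ b → m ≡ n → y ≐ b ÷ n → x ≐ a ÷ m
≐-resp refl refl refl yb = yb

≐-≤ : ∀ {x y a b m n} .{{_ : NonZero m}} .{{_ : NonZero n}} → x ≐ a ÷ m → y ≐ b ÷ n → a * n ≤ b * m → x ℚ.≤ y
≐-≤ {x} {y} {a} {b} {m} {n} (ratio xa) (ratio yb) le =
  ℚ.*-cancelʳ-≤-pos (ι m) {{ι-pos m}} (ℚ.*-cancelʳ-≤-pos (ι n) {{ι-pos n}} (begin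
    x ℚ.* ι m ℚ.* ι n      ≡⟨ cong (ℚ._* ι n) xa ⟩
    ι a ℚ.* ι n            ≡⟨ ι-* a n ⟨
    ι (a * n)              ≤⟨ ι-mono le ⟩
    ι (b * m)              ≡⟨ ι-* b m ⟩
    ι b ℚ.* ι m            ≡⟨ cong (ℚ._* ι m) yb ⟨
    y ℚ.* ι n ℚ.* ι m      ≡⟨ solve 3 (λ y m n → y :* n :* m := y :* m :* n) refl y (ι m) (ι n) ⟩
    y ℚ.* ι m ℚ.* ι n      ∎))
  where open ℚ.≤-Reasoning

/-mono-≤ : ∀ {a b m n} .{{_ : NonZero m}} .{{_ : NonZero n}} → a * n ≤ b * m → + a ℚ./ m ℚ.≤ + b ℚ./ n
/-mono-≤ {a} {b} {m} {n} = ≐-≤ {a = a} {b} {m} {n} (/-≐ a m) (/-≐ b n)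

0≤/ : ∀ a q .{{_ : NonZero q}} → 0ℚ ℚ.≤ + a ℚ./ q
0≤/ a q = ℚ.nonNegative⁻¹ (+ a ℚ./ q) {{ℚ.normalize-nonNeg a q}}

archimedean : ∀ {ε} → 0ℚ ℚ.< ε → ∀ c → ∃[ n ] + c ℚ./ suc n ℚ.≤ ε
-- Here ε = (a + 1)/(d + 1) is at least 1/(d + 1), while c/(c(d + 1) + 1) is at most 1/(d + 1).
archimedean {ε@(ℚ.mkℚ (+ suc a) d _)} _ c = c * suc d , subst (+ c ℚ./ suc (c * suc d) ℚ.≤_) (ℚ.↥p/↧p≡p ε)
  (/-mono-≤ {c} {suc a} {suc (c * suc d)} {suc d} (≤-trans (n≤1+n _) (m≤n*m (suc (c * suc d)) (suc a))))
archimedean {ℚ.mkℚ (+ zero) d _} (ℚ.*<* (ℤ.+<+ ())) c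
archimedean {ℚ.mkℚ -[1+ a ] d _} (ℚ.*<* ()) c

below-ℕ : ∀ x → ∃[ n ] x ℚ.≤ ι n
below-ℕ x@(ℚ.mkℚ (+ a) d _) = a , subst (ℚ._≤ ι a) (ℚ.↥p/↧p≡p x)
  (/-mono-≤ {a} {a} {suc d} {1} (*-monoʳ-≤ a (s≤s z≤n)))
below-ℕ x@(ℚ.mkℚ -[1+ a ] d _) = 0 , ℚ.<⇒≤ (ℚ.negative⁻¹ x)

≤-by-ε : ∀ {x y} → (∀ ε → 0ℚ ℚ.< ε → x ℚ.≤ y ℚ.+ ε) → x ℚ.≤ y
≤-by-ε {x} {y} le = ℚ.≮⇒≥ λ y<x → let (m , y<m , m<x) = ℚ.<-dense y<x in
  ℚ.<-irrefl refl (ℚ.<-≤-trans m<x (subst (x ℚ.≤_) (solve 2 (λ y m → y :+ (m :- y) := m) refl y m)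
    (le (m ℚ.- y) (subst (ℚ._< m ℚ.- y) (ℚ.+-inverseʳ y) (ℚ.+-monoˡ-< (ℚ.- y) y<m)))))

∣-∣-≤ : ∀ {x y ε} → x ℚ.≤ y ℚ.+ ε → y ℚ.≤ x ℚ.+ ε → ℚ.∣ x ℚ.- y ∣ ℚ.≤ ε
∣-∣-≤ {x} {y} {ε} x≤ y≤ with ℚ.∣p∣≡p∨∣p∣≡-p (x ℚ.- y)
... | inj₁ eq = subst (ℚ._≤ ε) (sym eq) (subst (x ℚ.- y ℚ.≤_) (cancel y ε) (ℚ.+-monoˡ-≤ (ℚ.- y) x≤))
  where
  cancel : ∀ y ε → y ℚ.+ ε ℚ.- y ≡ ε
  cancel = solve 2 (λ y ε → y :+ ε :- y := ε) refl
... | inj₂ eq = subst (ℚ._≤ ε) (sym (trans eq (swap x y))) (subst (y ℚ.- x ℚ.≤_) (cancel x ε) (ℚ.+-monoˡ-≤ (ℚ.- x) y≤))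
  where
  cancel : ∀ y ε → y ℚ.+ ε ℚ.- y ≡ ε
  cancel = solve 2 (λ y ε → y :+ ε :- y := ε) refl
  swap : ∀ x y → ℚ.- (x ℚ.- y) ≡ y ℚ.- x
  swap = solve 2 (λ x y → :- (x :- y) := y :- x) refl

x≤x+ε : ∀ x {ε} → 0ℚ ℚ.≤ ε → x ℚ.≤ x ℚ.+ ε
x≤x+ε x {ε} 0≤ε = subst (ℚ._≤ x ℚ.+ ε) (ℚ.+-identityʳ x) (ℚ.+-monoʳ-≤ x 0≤ε)

fromℕ-≤ : ∀ {m n} → m ≤ n → fromℕ m ≤ᴿ fromℕ n
fromℕ-≤ {n = n} m≤n ε 0<ε = 0 , λ _ _ → ℚ.≤-trans (ι-mono m≤n) (x≤x+ε (ι n) (ℚ.<⇒≤ 0<ε))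

fromℚ-cancel : ∀ {x y} → fromℚ x ≤ᴿ fromℚ y → x ℚ.≤ y
fromℚ-cancel le = ≤-by-ε λ ε 0<ε → let (N , x≤) = le ε 0<ε in x≤ N ≤-refl

-- From some index `N` on, all terms of a Cauchy sequence are within 1 of `seq T N`. This replaces
-- the real threshold in the hypothesis by a natural number.
ℝ-bounded : ∀ T → ∃[ K ] ∀ n → K ≤ n → T ≤ᴿ fromℕ n
ℝ-bounded T = let (N , close) = cauchy T 1ℚ (ℚ.positive⁻¹ 1ℚ)
                  (K , below) = below-ℕ (seq T N ℚ.+ 1ℚ) in
  K , λ n K≤n ε 0<ε → N , λ m N≤m → begin
    seq T m                              ≡⟨ solve 2 (λ x y → x := y :+ (x :- y)) refl (seq T m) (seq T N) ⟩
    seq T N ℚ.+ (seq T m ℚ.- seq T N)    ≤⟨ ℚ.+-monoʳ-≤ (seq T N) (x≤∣x∣ (seq T m ℚ.- seq T N)) ⟩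
    seq T N ℚ.+ ℚ.∣ seq T m ℚ.- seq T N ∣ ≤⟨ ℚ.+-monoʳ-≤ (seq T N) (close m N N≤m ≤-refl) ⟩
    seq T N ℚ.+ 1ℚ                       ≤⟨ below ⟩
    ι K                                  ≤⟨ ι-mono K≤n ⟩
    ι n                                  ≤⟨ x≤x+ε (ι n) (ℚ.<⇒≤ 0<ε) ⟩
    ι n ℚ.+ ε                            ∎
  where
  open ℚ.≤-Reasoning
  x≤∣x∣ : ∀ x → x ℚ.≤ ℚ.∣ x ∣
  x≤∣x∣ x with ℚ.≤-total 0ℚ x
  ... | inj₁ 0≤x = ℚ.≤-reflexive (sym (ℚ.0≤p⇒∣p∣≡p 0≤x))
  ... | inj₂ x≤0 = ℚ.≤-trans x≤0 (ℚ.0≤∣p∣ x)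

-- Listing S²(f, N)

least : {P : ℕ → Set} → Decidable P → ∀ {n} → P n → ∃[ m ] m ≤ n × P m × (∀ {k} → P k → m ≤ k)
least P? {n} Pn with P? 0
... | yes P0 = 0 , z≤n , P0 , λ _ → z≤n
least P? {zero}  Pn | no ¬P0 = contradiction Pn ¬P0
least {P} P? {suc n} Pn | no ¬P0 with least (P? ∘ suc) Pn
... | m , m≤n , Pm , min = suc m , s≤s m≤n , Pm , above
  where
  above : ∀ {k} → P k → suc m ≤ k
  above {zero}  P0 = contradiction P0 ¬P0
  above {suc k} Pk = s≤s (min Pk)

p²∤g0 : ∀ {p} → Prime p → ¬ p ^ 2 ∣ g 0
p²∤g0 {p} pr p²∣2 = <⇒≱ (s≤s (s≤s (s≤s z≤n))) 4≤2
  where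
  4≤2 : 4 ≤ 2
  4≤2 = ≤-trans (^-monoˡ-≤ 2 (nonTrivial⇒n>1 p {{prime⇒nonTrivial pr}})) (∣⇒≤ p²∣2)

-- A root in 1, ..., N bounds the least root, which is R_f(p²) because evenness of `f` reduces every
-- integer root to its absolute value. Conversely, an integer attaining R_f(p²) is nonzero by
-- `p²∤g0`.
reached⇔S² : ∀ N p → Reached N p ⇔ S² f (fromℕ N) p
reached⇔S² N p = mk⇔ to from
  where
  to : Reached N p → S² f (fromℕ N) p
  to (pr , i , i<N , p²∣) with least (λ d → p ^ 2 ∣? g d) {suc i} p²∣
  ... | r , r≤ , p²∣gr , min = pr , [ r ] ,
    ((+ r , refl , subst (p ^ 2 ∣_) (sym (∣f∣≡g (+ r))) p²∣gr) ,
     λ d p²∣fd → min (subst (p ^ 2 ∣_) (∣f∣≡g d) p²∣fd)) ,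
    fromℕ-≤ (≤-trans r≤ i<N)
  from : S² f (fromℕ N) p → Reached N p
  from (pr , [ r ] , ((d , refl , p²∣) , _) , r≤N) =
    go ℤ.∣ d ∣ (ι-cancel (fromℚ-cancel r≤N)) (subst (p ^ 2 ∣_) (∣f∣≡g d) p²∣)
    where
    go : ∀ r → r ≤ N → p ^ 2 ∣ g r → Reached N p
    go zero    _   p²∣g = contradiction p²∣g (p²∤g0 pr)
    go (suc i) i<N p²∣g = pr , i , i<N , p²∣g

S²-card : ∀ N z → HasCard (S² f (fromℕ N)) (reachedCount N z)
S²-card N z = xs , Unique.filter⁺ (reached? N) (Unique.upTo⁺ (bound N z)) , (λ p → mk⇔ to from) ,
              count-length (reached? N) (bound N z)
  where
  xs = filter (reached? N) (upTo (bound N z))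
  to : ∀ {p} → p ∈ xs → S² f (fromℕ N) p
  to {p} p∈ = Equivalence.to (reached⇔S² N p) (proj₂ (∈-filter⁻ (reached? N) {xs = upTo (bound N z)} p∈))
  from : ∀ {p} → S² f (fromℕ N) p → p ∈ xs
  from {p} p∈S = ∈-filter⁺ (reached? N) (∈-upTo⁺ (≤-trans (s≤s (reached-≤ r)) (m≤n+m _ (suc z)))) r
    where
    r : Reached N p
    r = Equivalence.from (reached⇔S² N p) p∈S

-- The partial Euler products and their limit

euler-≐ : ∀ z → eulerFactor f (suc z) ≐ nonroots (suc z ^ 2) ÷ suc z ^ 2
euler-≐ z = ≐-complement (/-≐ (δ f (suc z ^ 2)) (suc z ^ 2)) (δ+nonroots (suc z ^ 2))

𝒫 : ℕ → ℚ
𝒫 = primeProductUpTo (eulerFactor f)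

module _ (a : (p : ℕ) .{{_ : NonZero p}} → ℚ) {n : ℕ} where

  primeProduct-suc : Prime (suc n) → primeProductUpTo a (suc n) ≡ primeProductUpTo a n ℚ.* a (suc n)
  primeProduct-suc pr with prime? (suc n)
  ... | yes _  = refl
  ... | no ¬pr = contradiction pr ¬pr

  primeProduct-skip : ¬ Prime (suc n) → primeProductUpTo a (suc n) ≡ primeProductUpTo a n
  primeProduct-skip ¬pr with prime? (suc n)
  ... | yes pr = contradiction pr ¬pr
  ... | no _   = refl

𝒫-≐ : ∀ z → 𝒫 z ≐ survivors z ÷ period z
𝒫-≐ zero = ratio refl
𝒫-≐ (suc z) = go (prime? (suc z))
  where
  go : Dec (Prime (suc z)) → 𝒫 (suc z) ≐ survivors (suc z) ÷ period (suc z)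
  go (no ¬pr) = ≐-resp (primeProduct-skip (eulerFactor f) ¬pr) (survivors-skip ¬pr) (period-skip ¬pr) (𝒫-≐ z)
  go (yes pr) = ≐-resp (primeProduct-suc (eulerFactor f) pr) (survivors-suc pr) (period-suc pr)
    (≐-* (𝒫-≐ z) (euler-≐ z))

survivors≤period : ∀ z → survivors z ≤ period z
survivors≤period z = ≤-trans (∑-mono (period z) (λ {i} _ → χ≤1 (avoids? z i)))
  (≤-reflexive (trans (∑-const (period z) 1) (*-identityʳ _)))

0≤𝒫 : ∀ z → 0ℚ ℚ.≤ 𝒫 z
0≤𝒫 z = ≐-≤ {m = 1} {n = period z} {{_}} {{period-nonZero z}} (/-≐ 0 1) (𝒫-≐ z) z≤n

𝒫≤1 : ∀ z → 𝒫 z ℚ.≤ 1ℚ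
𝒫≤1 z = ≐-≤ {m = period z} {n = 1} {{period-nonZero z}} (𝒫-≐ z) (/-≐ 1 1)
  (subst₂ _≤_ (sym (*-identityʳ _)) (sym (+-identityʳ _)) (survivors≤period z))

-- With w = n + 2 it suffices that 4/w² ≤ 4/(w - 1) - 4/w, the comparison behind `/-telescope`, now
-- for rationals.
telescope : ∀ {a} n → a ≤ 4 → + a ℚ./ (suc (suc n) ^ 2) ℚ.+ + 4 ℚ./ suc (suc n) ℚ.≤ + 4 ℚ./ suc n
telescope {a} n a≤4 = ≐-≤ (≐-+ (/-≐ a (w ^ 2)) (/-≐ 4 w)) (/-≐ 4 (suc n)) (begin
    (a * w + 4 * w ^ 2) * suc n    ≤⟨ *-monoˡ-≤ (suc n) (+-monoˡ-≤ (4 * w ^ 2) (*-monoˡ-≤ w a≤4)) ⟩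
    (4 * w + 4 * w ^ 2) * suc n    ≤⟨ m≤m+n _ (4 * w) ⟩
    (4 * w + 4 * w ^ 2) * suc n + 4 * w ≡⟨ S.solve 1 (λ n → let w = S.con 2 S.:+ n; w² = w S.:* (w S.:* S.con 1) in
        (S.con 4 S.:* w S.:+ S.con 4 S.:* w²) S.:* (S.con 1 S.:+ n) S.:+ S.con 4 S.:* w S.:= S.con 4 S.:* (w² S.:* w)) refl n ⟩
    4 * (w ^ 2 * w)                ∎)
  where
  open ≤-Reasoning
  w = suc (suc n)

-- A lower companion of `𝒫`: this sequence increases while `𝒫` decreases, and their gap 4/z tends to
-- 0, so together they enclose the limit.
margin : ℕ → ℚ
margin n = 𝒫 (suc n) ℚ.- + 4 ℚ./ suc n

margin-suc : ∀ n → margin n ℚ.≤ margin (suc n)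
margin-suc n = subst₂ ℚ._≤_
  (solve 3 (λ x a b → x :+ b :- (a :+ b) := x :- a) refl x (+ 4 ℚ./ suc n) (+ 4 ℚ./ w))
  (solve 3 (λ x a b → x :+ a :- (a :+ b) := x :- b) refl (𝒫 w) (+ 4 ℚ./ suc n) (+ 4 ℚ./ w))
  (ℚ.+-monoˡ-≤ (ℚ.- (+ 4 ℚ./ suc n ℚ.+ + 4 ℚ./ w)) (go (prime? w)))
  where
  open ℚ.≤-Reasoning
  w = suc (suc n)
  d = + δ f (w ^ 2) ℚ./ (w ^ 2)
  x = 𝒫 (suc n)
  go : Dec (Prime w) → 𝒫 (suc n) ℚ.+ + 4 ℚ./ w ℚ.≤ 𝒫 w ℚ.+ + 4 ℚ./ suc n
  go (no ¬pr) = ℚ.+-mono-≤ (ℚ.≤-reflexive (sym (primeProduct-skip (eulerFactor f) ¬pr))) (/-mono-≤ {4} {4} {w} {suc n} (*-monoʳ-≤ 4 (n≤1+n (suc n))))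
  -- Passing from x to x(1 - d) loses xd, which is at most d because partial products do not exceed
  -- 1; `telescope` pays for d.
  go (yes pr) = begin
    x ℚ.+ + 4 ℚ./ w                                  ≡⟨ solve 3 (λ x d e → x :+ e := x :* (con 1ℚ :- d) :+ (x :* d :+ e)) refl x d (+ 4 ℚ./ w) ⟩
    x ℚ.* (1ℚ ℚ.- d) ℚ.+ (x ℚ.* d ℚ.+ + 4 ℚ./ w)     ≤⟨ ℚ.+-monoʳ-≤ (x ℚ.* (1ℚ ℚ.- d)) (ℚ.+-monoˡ-≤ (+ 4 ℚ./ w) x*d≤d) ⟩
    x ℚ.* (1ℚ ℚ.- d) ℚ.+ (d ℚ.+ + 4 ℚ./ w)           ≤⟨ ℚ.+-monoʳ-≤ (x ℚ.* (1ℚ ℚ.- d)) (telescope n (δ≤4 pr)) ⟩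
    x ℚ.* (1ℚ ℚ.- d) ℚ.+ + 4 ℚ./ suc n               ≡⟨ cong (ℚ._+ + 4 ℚ./ suc n) (primeProduct-suc (eulerFactor f) pr) ⟨
    𝒫 w ℚ.+ + 4 ℚ./ suc n                            ∎
    where
    x*d≤d : x ℚ.* d ℚ.≤ d
    x*d≤d = ℚ.≤-trans (ℚ.*-monoʳ-≤-nonNeg d {{ℚ.normalize-nonNeg (δ f (w ^ 2)) (w ^ 2)}} (𝒫≤1 (suc n)))
                      (ℚ.≤-reflexive (ℚ.*-identityˡ d))

𝒫-antitone-suc : ∀ z → 𝒫 (suc z) ℚ.≤ 𝒫 z
𝒫-antitone-suc z = go (prime? (suc z))
  where
  q = suc z ^ 2
  go : Dec (Prime (suc z)) → 𝒫 (suc z) ℚ.≤ 𝒫 z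
  go (no ¬pr) = ℚ.≤-reflexive (primeProduct-skip (eulerFactor f) ¬pr)
  go (yes pr) = ℚ.≤-trans (ℚ.≤-reflexive (primeProduct-suc (eulerFactor f) pr)) (ℚ.≤-trans
    (ℚ.*-monoˡ-≤-nonNeg (𝒫 z) {{ℚ.nonNegative (0≤𝒫 z)}} e≤1) (ℚ.≤-reflexive (ℚ.*-identityʳ (𝒫 z))))
    where
    e≤1 : eulerFactor f (suc z) ℚ.≤ 1ℚ
    e≤1 = ≐-≤ (euler-≐ z) (/-≐ 1 1) (subst₂ _≤_ (sym (*-identityʳ _)) (sym (+-identityʳ q))
      (≤-trans (m≤n+m _ (δ f q)) (≤-reflexive (δ+nonroots q))))

antitone : ∀ {a : ℕ → ℚ} → (∀ n → a (suc n) ℚ.≤ a n) → ∀ {m n} → m ≤′ n → a n ℚ.≤ a m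
antitone step ≤′-refl        = ℚ.≤-refl
antitone step (≤′-step m≤′n) = ℚ.≤-trans (step _) (antitone step m≤′n)

monotone : ∀ {a : ℕ → ℚ} → (∀ n → a n ℚ.≤ a (suc n)) → ∀ {m n} → m ≤′ n → a m ℚ.≤ a n
monotone step ≤′-refl        = ℚ.≤-refl
monotone step (≤′-step m≤′n) = ℚ.≤-trans (monotone step m≤′n) (step _)

𝒫-antitone : ∀ {m n} → m ≤ n → 𝒫 n ℚ.≤ 𝒫 m
𝒫-antitone m≤n = antitone {𝒫} 𝒫-antitone-suc (≤⇒≤′ m≤n)

𝒫-tail : ∀ z {m} → suc z ≤ m → 𝒫 (suc z) ℚ.≤ 𝒫 m ℚ.+ + 4 ℚ./ suc z
𝒫-tail z {suc m} (s≤s z≤m) = begin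
  𝒫 (suc z)                                   ≡⟨ solve 2 (λ x a → x := x :- a :+ a) refl (𝒫 (suc z)) (+ 4 ℚ./ suc z) ⟩
  margin z ℚ.+ + 4 ℚ./ suc z                   ≤⟨ ℚ.+-monoˡ-≤ (+ 4 ℚ./ suc z) (monotone {margin} margin-suc (≤⇒≤′ z≤m)) ⟩
  𝒫 (suc m) ℚ.- + 4 ℚ./ suc m ℚ.+ + 4 ℚ./ suc z   ≤⟨ ℚ.+-monoˡ-≤ (+ 4 ℚ./ suc z) drop ⟩
  𝒫 (suc m) ℚ.+ + 4 ℚ./ suc z                 ∎
  where
  open ℚ.≤-Reasoning
  drop : 𝒫 (suc m) ℚ.- + 4 ℚ./ suc m ℚ.≤ 𝒫 (suc m)
  drop = ℚ.≤-trans (ℚ.+-monoʳ-≤ (𝒫 (suc m)) (ℚ.neg-antimono-≤ (0≤/ 4 (suc m)))) (ℚ.≤-reflexive (ℚ.+-identityʳ _))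

𝒫-close : ∀ z {m n} → suc z ≤ m → suc z ≤ n → 𝒫 m ℚ.≤ 𝒫 n ℚ.+ + 4 ℚ./ suc z
𝒫-close z z<m z<n = ℚ.≤-trans (𝒫-antitone z<m) (𝒫-tail z z<n)

𝒫-cauchy : Cauchy 𝒫
𝒫-cauchy ε 0<ε = let (z , 4/z≤ε) = archimedean 0<ε 4 in
  suc z , λ m n z<m z<n → ℚ.≤-trans (∣-∣-≤ (𝒫-close z z<m z<n) (𝒫-close z z<n z<m)) 4/z≤ε

-- Represented by the partial products themselves, so that convergence of the product restates
-- `𝒫-cauchy`, and positivity only needs a lower bound for `𝒫 n` from some `n` on.
density : ℝ
density = real 𝒫 𝒫-cauchy

𝒫-converges : IsPrimeProduct (eulerFactor f) density
𝒫-converges ε 0<ε = let (N , close) = 𝒫-cauchy ε 0<ε in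
  N , λ n N≤n ε′ 0<ε′ → N , λ m N≤m →
    ℚ.≤-trans (close n m N≤n N≤m) (x≤x+ε ε (ℚ.<⇒≤ 0<ε′))

-- By evaluation: no fourth power is - 2 modulo 4, 5 or 7, and the roots modulo 9 are 2 and 7.
𝒫8≡7/9 : 𝒫 8 ≡ + 7 ℚ./ 9
𝒫8≡7/9 = refl

-- δ(4) = δ(25) = δ(49) = 0 and δ(9) = 2, so the product up to 8 is 7/9, and the tail costs at most 4/8.
density-positive : fromℕ 0 <ᴿ density
density-positive = + 5 ℚ./ 18 , ℚ.positive⁻¹ (+ 5 ℚ./ 18) , 8 , λ n 8≤n → begin
  0ℚ ℚ.+ + 5 ℚ./ 18                    ≡⟨⟩
  + 7 ℚ./ 9 ℚ.- + 4 ℚ./ 8              ≤⟨ ℚ.+-monoˡ-≤ (ℚ.- (+ 4 ℚ./ 8)) (subst (ℚ._≤ 𝒫 n ℚ.+ + 4 ℚ./ 8) 𝒫8≡7/9 (𝒫-tail 7 8≤n)) ⟩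
  𝒫 n ℚ.+ + 4 ℚ./ 8 ℚ.- + 4 ℚ./ 8      ≡⟨ solve 2 (λ x a → x :+ a :- a := x) refl (𝒫 n) (+ 4 ℚ./ 8) ⟩
  𝒫 n                                  ∎
  where open ℚ.≤-Reasoning

-- The sieve estimate and the passage to the limit

module Estimate (z N : ℕ) .{{_ : NonZero z}} .{{_ : NonZero N}}
  (large : z * period z ≤ N) (few : reachedCount N z * z ≤ N) where

  M = period z
  C = survivors z
  Q = count squareFree? N
  A = count (avoids? z) N

  instance
    M≢0 : NonZero M
    M≢0 = period-nonZero z
    Mz≢0 : NonZero (M * z)
    Mz≢0 = m*n≢0 M z
    Nz≢0 : NonZero (N * z)
    Nz≢0 = m*n≢0 N z

  open ≤-Reasoning

  -- The hypothesis `large` is made for this: the error from the incomplete last period, relative to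
  -- `N`, is at most 1/z.
  defect-≤ : M * C * z ≤ N * M
  defect-≤ = begin
    M * C * z      ≡⟨ S.solve 3 (λ m c z → m S.:* c S.:* z S.:= z S.:* m S.:* c) refl M C z ⟩
    z * M * C      ≤⟨ *-mono-≤ large (survivors≤period z) ⟩
    N * M          ∎

  sieve-upper : + Q ℚ./ N ℚ.≤ 𝒫 z ℚ.+ + 1 ℚ./ z
  sieve-upper = ≐-≤ (/-≐ Q N) (≐-+ (𝒫-≐ z) (/-≐ 1 z)) (begin
    Q * (M * z)                  ≤⟨ *-monoˡ-≤ (M * z) (squareFree≤avoids z N) ⟩
    A * (M * z)                  ≡⟨ *-assoc A M z ⟨
    A * M * z                    ≤⟨ *-monoˡ-≤ z (count-upper (avoids? z) (avoids-periodic z) N) ⟩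
    (N * C + M * C) * z          ≡⟨ *-distribʳ-+ z (N * C) (M * C) ⟩
    N * C * z + M * C * z        ≤⟨ +-monoʳ-≤ (N * C * z) defect-≤ ⟩
    N * C * z + N * M            ≡⟨ S.solve 4 (λ n c z m → n S.:* c S.:* z S.:+ n S.:* m S.:= (c S.:* z S.:+ S.con 1 S.:* m) S.:* n) refl N C z M ⟩
    (C * z + 1 * M) * N          ∎)

  -- The constant is 9 = 4 + 4 + 1: four for the reached primes by `few`, four for the sum of N/p²,
  -- one for the incomplete period.
  sieve-lower : 𝒫 z ℚ.≤ + Q ℚ./ N ℚ.+ + 9 ℚ./ z
  sieve-lower = ≐-≤ (𝒫-≐ z) (≐-+ (/-≐ Q N) (/-≐ 9 z)) (begin
    C * (N * z)                  ≡⟨ S.solve 3 (λ c n z → c S.:* (n S.:* z) S.:= n S.:* c S.:* z) refl C N z ⟩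
    N * C * z                    ≤⟨ *-monoˡ-≤ z (count-lower (avoids? z) (avoids-periodic z) N) ⟩
    (A * M + M * C) * z          ≡⟨ S.solve 4 (λ a m c z → (a S.:* m S.:+ m S.:* c) S.:* z S.:= a S.:* z S.:* m S.:+ m S.:* c S.:* z) refl A M C z ⟩
    A * z * M + M * C * z        ≤⟨ +-mono-≤ (*-monoˡ-≤ M Az≤) defect-≤ ⟩
    (Q * z + 8 * N) * M + N * M  ≡⟨ S.solve 4 (λ q z n m → (q S.:* z S.:+ S.con 8 S.:* n) S.:* m S.:+ n S.:* m S.:= (q S.:* z S.:+ S.con 9 S.:* n) S.:* m) refl Q z N M ⟩
    (Q * z + 9 * N) * M          ∎)
    where
    k = reachedCount N z
    Az≤ : A * z ≤ Q * z + 8 * N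
    Az≤ = begin
      A * z                              ≤⟨ *-monoˡ-≤ z (avoids≤squareFree z N) ⟩
      (Q + 4 * (k + N / z)) * z          ≡⟨ S.solve 4 (λ q k t z → (q S.:+ S.con 4 S.:* (k S.:+ t)) S.:* z S.:= q S.:* z S.:+ S.con 4 S.:* (k S.:* z S.:+ t S.:* z)) refl Q k (N / z) z ⟩
      Q * z + 4 * (k * z + N / z * z)    ≤⟨ +-monoʳ-≤ (Q * z) (*-monoʳ-≤ 4 (+-mono-≤ few (m/n*n≤m N z))) ⟩
      Q * z + 4 * (N + N)                ≡⟨ cong (_+_ (Q * z)) (S.solve 1 (λ n → S.con 4 S.:* (n S.:+ n) S.:= S.con 8 S.:* n) refl N) ⟩
      Q * z + 8 * N                      ∎

/-combine : ∀ {x y w} a b c z .{{_ : NonZero z}} → x ℚ.≤ y ℚ.+ + a ℚ./ z → y ℚ.≤ w ℚ.+ + b ℚ./ z →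
            a + b ≤ c → x ℚ.≤ w ℚ.+ + c ℚ./ z
/-combine {x} {y} {w} a b c z x≤ y≤ a+b≤c = begin
  x                                        ≤⟨ x≤ ⟩
  y ℚ.+ + a ℚ./ z                          ≤⟨ ℚ.+-monoˡ-≤ (+ a ℚ./ z) y≤ ⟩
  w ℚ.+ + b ℚ./ z ℚ.+ + a ℚ./ z            ≡⟨ solve 3 (λ w b a → w :+ b :+ a := w :+ (a :+ b)) refl w (+ b ℚ./ z) (+ a ℚ./ z) ⟩
  w ℚ.+ (+ a ℚ./ z ℚ.+ + b ℚ./ z)          ≤⟨ ℚ.+-monoʳ-≤ w (≐-≤ {m = z * z} {n = z} {{m*n≢0 z z}} (≐-+ (/-≐ a z) (/-≐ b z)) (/-≐ c z) le) ⟩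
  w ℚ.+ + c ℚ./ z                          ∎
  where
  open ℚ.≤-Reasoning
  le : (a * z + b * z) * z ≤ c * (z * z)
  le = ≤-trans (≤-reflexive (S.solve 3 (λ a b z → (a S.:* z S.:+ b S.:* z) S.:* z S.:= (a S.:+ b) S.:* (z S.:* z)) refl a b z))
               (*-monoˡ-≤ (z * z) a+b≤c)

-- The hypothesis with ε = 1/z and T = N, applied to the cardinality supplied by `S²-card`.
few-reached : CardIsLittleO (S² f) → ∀ z .{{_ : NonZero z}} → ∃[ K ] ∀ N → K ≤ N → reachedCount N z * z ≤ N
few-reached small z = let (T₀ , bounded) = small (+ 1 ℚ./ z) (ℚ.positive⁻¹ _ {{ℚ.normalize-pos 1 z}})
                          (K , T₀≤)      = ℝ-bounded T₀ in
  K , λ N K≤N → ι-cancel (begin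
    ι (reachedCount N z * z)        ≡⟨ ι-* (reachedCount N z) z ⟩
    ι (reachedCount N z) ℚ.* ι z    ≤⟨ ℚ.*-monoʳ-≤-nonNeg (ι z) {{ℚ.normalize-nonNeg z 1}}
                                         (fromℚ-cancel {y = + 1 ℚ./ z ℚ.* ι N} (bounded (fromℕ N) (T₀≤ N K≤N) _ (S²-card N z))) ⟩
    + 1 ℚ./ z ℚ.* ι N ℚ.* ι z       ≡⟨ solve 3 (λ v n z → v :* n :* z := v :* z :* n) refl (+ 1 ℚ./ z) (ι N) (ι z) ⟩
    + 1 ℚ./ z ℚ.* ι z ℚ.* ι N       ≡⟨ trans (cong (ℚ._* ι N) (cleared (/-≐ 1 z))) (ℚ.*-identityˡ (ι N)) ⟩
    ι N                             ∎)
  where open ℚ.≤-Reasoning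

squareFree-density : CardIsLittleO (S² f) → HasNaturalDensity (λ d → Squarefree (f (+ d))) density
squareFree-density small = count squareFree? , squareFree-card , converges
  where
  converges : (λ n → + count squareFree? (suc n) ℚ./ suc n) ⟶ density
  -- The numerator 13 covers both directions: 1 + 4 from `sieve-upper` and the tail of the product,
  -- and 9 from `sieve-lower`, where passing from `𝒫 m` to the earlier partial product is free by
  -- monotonicity. The index `m` runs along the sequence representing `density`.
  converges ε 0<ε = let (z , 13/z≤ε) = archimedean 0<ε 13
                        (K , few)    = few-reached small (suc z) in
    K ⊔ suc z * period (suc z) , λ n large ε′ 0<ε′ → suc z , λ m z<m →
      let N    = suc n
          N≥   = ≤-trans large (n≤1+n n)
          open Estimate (suc z) N (m⊔n≤o⇒n≤o K _ N≥) (few N (m⊔n≤o⇒m≤o K _ N≥)) using (sieve-upper; sieve-lower)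
      in ℚ.≤-trans
           (∣-∣-≤ (/-combine {w = 𝒫 m} 1 4 13 (suc z) sieve-upper (𝒫-tail z z<m) (m≤m+n 5 8))
                  (/-combine {w = + count squareFree? N ℚ./ N} 0 9 13 (suc z) (ℚ.≤-trans (𝒫-antitone z<m) (x≤x+ε (𝒫 (suc z)) (0≤/ 0 (suc z)))) sieve-lower (m≤m+n 9 4)))
           (ℚ.≤-trans 13/z≤ε (x≤x+ε ε (ℚ.<⇒≤ 0<ε′)))

theorem3 : CardIsLittleO (S² f) →
    ∃[ D ] HasNaturalDensity (λ d → Squarefree (f (+ d))) D
    × fromℕ 0 <ᴿ D
    × IsPrimeProduct (eulerFactor f) D
theorem3 small = density , squareFree-density small , density-positive , 𝒫-converges
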